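{- Let $Q$ be a skew symmetric core of order $q$ with $q>1$, and let $m$ be a positive integer. Then the quaternary unit Hadamard matrix $$\frac{1}{\sqrt{q+1}}\,\mathcal{J}^{(q)}_m+i\sqrt{\frac{q}{q+1}}\,\mathcal{A}^{(q)}_m$$ is in the Bose-Mesner algebra of the association scheme $\mathfrak{X}^{(q)}_m$.
   Context: A Hadamard matrix of order $n$ is an $n\times n$ $(\pm1)$-matrix $H$ with $HH^T=nI_n$; it is of skew type if $H=I+W$ with $W$ a skew symmetric $(0,\pm1)$-matrix. A skew symmetric core of order $q$ is a $q\times q$ matrix $Q$ such that $\begin{pmatrix}1 & j\\ -j^T & I+Q\end{pmatrix}$ is a skew type Hadamard matrix of order $q+1$, where $j$ is the $1\times q$ all-ones matrix. Such $Q$ is a skew symmetric $(0,\pm1)$-matrix with $J_qQ=QJ_q=0$ and $QQ^T=qI_q-J_q$, where $J_n$ denotes the $n\times n$ all-ones matrix. Given $Q$, define recursively $\mathcal{J}^{(q)}_0=\mathcal{A}^{(q)}_0=J_1$ and, for $m\ge1$, $\mathcal{J}^{(q)}_m=J_q\otimes\mathcal{A}^{(q)}_{m-1}$, $\mathcal{A}^{(q)}_m=I_q\otimes\mathcal{J}^{(q)}_{m-1}+Q\otimes\mathcal{A}^{(q)}_{m-1}$. Write $Q=A_1-A_2$ with $A_1,A_2$ disjoint $(0,1)$-matrices (no common nonzero position), and let $A_0=I_q$. The matrices $A_0,A_1,A_2$ are the adjacency matrices of a commutative association scheme $\mathfrak{X}^{(q)}$. The association scheme $\mathfrak{X}^{(q)}_m$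 is the $m$-fold tensor product of $\mathfrak{X}^{(q)}$: its adjacency matrices are $A_{i_1}\otimes\cdots\otimes A_{i_m}$ with $(i_1,\dots,i_m)\in\{0,1,2\}^m$. The Bose-Mesner algebra of an association scheme is the complex vector space spanned by its adjacency matrices. A quaternary unit Hadamard matrix (with parameter $q$) of order $n$ is an $n\times n$ complex matrix $H$ with $HH^*=nI_n$ and all entries in $\left\{\epsilon\frac{1}{\sqrt{q+1}}+\delta\, i\sqrt{\frac{q}{q+1}} : \epsilon,\delta\in\{1,-1\}\right\}$. -}

module Defs where

import Algebra.Properties.CommutativeSemigroup
open import Algebra.Bundles using (CommutativeRing)
open import Algebra.Structures using (IsCommutativeRing)
open import Data.Bool using (if_then_else_)
open import Data.Fin as Fin using (Fin; zero; suc; quotient; remainder; combine; _↑ˡ_; _↑ʳ_)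
import Data.Fin.Properties as Fin
open import Data.Integer as ℤ using (ℤ; +_; -[1+_]; -1ℤ)
import Data.Integer.Properties as ℤP
open import Data.Integer.Tactic.RingSolver using (solve-∀)
open import Data.Nat as ℕ using (ℕ; zero; suc)
import Data.Nat.Properties as ℕP
open import Data.Nat.Solver using () renaming (module +-*-Solver to ℕ-Solver)
open import Data.Product using (∃; ∃₂; _×_; _,_; proj₁; proj₂)
open import Data.Rational as ℚ using (ℚ; 0ℚ; 1ℚ; ½)
import Data.Rational.Properties as ℚP
open import Data.Rational.Solver using (module +-*-Solver)
import Data.Rational.Unnormalised as ℚᵘ
import Data.Rational.Unnormalised.Properties as ℚᵘP
open import Data.Sum using (_⊎_; inj₁; inj₂)
open import Function using (_∘_)
open import Level using (0ℓ)
open import Relation.Binary.PropositionalEquality using (_≡_; _≢_; refl; sym; trans; cong; cong₂; subst; subst₂; module ≡-Reasoning)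
open import Relation.Nullary using (¬_; Dec; does; yes; no; contradiction)

module Close where

  open import Data.Rational using (_+_; _*_; _-_; -_; ∣_∣; _<_; _≤_)
  open +-*-Solver using (solve; _:+_; _:*_; _:-_; :-_; _:=_)

  abstract

    half : ℚ → ℚ
    half ε = ½ * ε

    halves : ∀ ε → half ε + half ε ≡ ε
    halves ε = trans (sym (ℚP.*-distribʳ-+ ε ½ ½)) (ℚP.*-identityˡ ε)

    half-pos : ∀ {ε} → 0ℚ < ε → 0ℚ < half ε
    half-pos {ε} 0<ε = subst (_< half ε) (ℚP.*-zeroʳ ½) (ℚP.*-monoʳ-<-pos ½ 0<ε)

    self : ∀ a {ε} → 0ℚ < ε → ∣ a - a ∣ < ε
    self a {ε} 0<ε = subst (_< ε) (sym (cong ∣_∣ (ℚP.+-inverseʳ a))) 0<ε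

    swap : ∀ a b {ε} → ∣ a - b ∣ < ε → ∣ b - a ∣ < ε
    swap a b {ε} = subst (_< ε) (trans (sym (ℚP.∣-p∣≡∣p∣ (a - b)))
      (cong ∣_∣ (solve 2 (λ x y → :- (x :- y) := y :- x) refl a b)))

    neg : ∀ a b {ε} → ∣ a - b ∣ < ε → ∣ - a - (- b) ∣ < ε
    neg a b {ε} = subst (_< ε) (trans (sym (ℚP.∣-p∣≡∣p∣ (a - b)))
      (cong ∣_∣ (solve 2 (λ x y → :- (x :- y) := (:- x) :- (:- y)) refl a b)))

    sum-< : ∀ p q ε → ∣ p ∣ < half ε → ∣ q ∣ < half ε → ∣ p + q ∣ < ε
    sum-< p q ε p< q< = ℚP.≤-<-trans (ℚP.∣p+q∣≤∣p∣+∣q∣ p q)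
      (subst (∣ p ∣ + ∣ q ∣ <_) (halves ε) (ℚP.+-mono-< p< q<))

    add : ∀ a b c d {ε} → ∣ a - b ∣ < half ε → ∣ c - d ∣ < half ε → ∣ (a + c) - (b + d) ∣ < ε
    add a b c d {ε} p q = subst (λ t → ∣ t ∣ < ε)
      (solve 4 (λ a b c d → (a :- b) :+ (c :- d) := (a :+ c) :- (b :+ d)) refl a b c d)
      (sum-< (a - b) (c - d) ε p q)

    chain : ∀ a b c {ε} → ∣ a - b ∣ < half ε → ∣ b - c ∣ < half ε → ∣ a - c ∣ < ε
    chain a b c {ε} p q = subst (λ t → ∣ t ∣ < ε)
      (solve 3 (λ a b c → (a :- b) :+ (b :- c) := a :- c) refl a b c)
      (sum-< (a - b) (b - c) ε p q)

    tolerance : ∀ (B : ℚ) → .{{ℚ.Positive B}} → ℚ → ℚ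
    tolerance B ε = (ℚ.1/ B) {{ℚP.pos⇒nonZero B}} * half ε

    tolerance-* : ∀ B .{{_ : ℚ.Positive B}} ε → B * tolerance B ε ≡ half ε
    tolerance-* B ε = trans (sym (ℚP.*-assoc B ((ℚ.1/ B) {{ℚP.pos⇒nonZero B}}) (half ε)))
      (trans (cong (_* half ε) (ℚP.*-inverseʳ B {{ℚP.pos⇒nonZero B}})) (ℚP.*-identityˡ (half ε)))

    tolerance-pos : ∀ B .{{_ : ℚ.Positive B}} {ε} → 0ℚ < ε → 0ℚ < tolerance B ε
    tolerance-pos B {ε} 0<ε = ℚP.*-cancelˡ-<-nonNeg B {{ℚP.pos⇒nonNeg B}}
      (subst₂ _<_ (sym (ℚP.*-zeroʳ B)) (sym (tolerance-* B ε)) (half-pos 0<ε))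

    prod-< : ∀ B .{{_ : ℚ.Positive B}} x y ε → ∣ x ∣ < B → ∣ y ∣ < tolerance B ε →
             ∣ x * y ∣ < half ε
    prod-< B x y ε x< y< = subst₂ _<_ (sym (ℚP.∣p*q∣≡∣p∣*∣q∣ x y)) (tolerance-* B ε)
      (ℚP.≤-<-trans
        (ℚP.*-monoʳ-≤-nonNeg ∣ y ∣ {{ℚ.nonNegative (ℚP.0≤∣p∣ y)}} (ℚP.<⇒≤ x<))
        (ℚP.*-monoʳ-<-pos B y<))

    mul : ∀ B .{{_ : ℚ.Positive B}} a b c d {ε} → ∣ a ∣ < B → ∣ d ∣ < B →
          ∣ a - b ∣ < tolerance B ε → ∣ c - d ∣ < tolerance B ε → ∣ a * c - b * d ∣ < ε
    mul B a b c d {ε} a< d< p q = subst (λ t → ∣ t ∣ < ε)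
      (solve 4 (λ a b c d → a :* (c :- d) :+ d :* (a :- b) := a :* c :- b :* d) refl a b c d)
      (sum-< (a * (c - d)) (d * (a - b)) ε (prod-< B a (c - d) ε a< q) (prod-< B d (a - b) ε d< p))

    bound : ∀ a b → ∣ b - a ∣ < 1ℚ → ∣ b ∣ < ∣ a ∣ + 1ℚ
    bound a b p = subst (λ t → ∣ t ∣ < ∣ a ∣ + 1ℚ)
      (solve 2 (λ a b → a :+ (b :- a) := b) refl a b)
      (ℚP.≤-<-trans (ℚP.∣p+q∣≤∣p∣+∣q∣ a (b - a)) (ℚP.+-monoʳ-< ∣ a ∣ p))

-- ℝ is the type of Cauchy sequences of rationals (with a modulus of convergence), as a setoid under _≈ᴿ_.

Cauchy : (ℕ → ℚ) → Set
Cauchy s = ∀ ε → 0ℚ ℚ.< ε → ∃ λ N → ∀ m n → N ℕ.≤ m → N ℕ.≤ n → ℚ.∣ s m ℚ.- s n ∣ ℚ.< ε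

record ℝ : Set where
  field
    seq    : ℕ → ℚ
    cauchy : Cauchy seq
open ℝ

infix 4 _≈ᴿ_
record _≈ᴿ_ (x y : ℝ) : Set where
  field
    close : ∀ ε → 0ℚ ℚ.< ε → ∃ λ N → ∀ n → N ℕ.≤ n → ℚ.∣ seq x n ℚ.- seq y n ∣ ℚ.< ε
open _≈ᴿ_

⊔ˡ : ∀ {m n k} → m ℕ.⊔ n ℕ.≤ k → m ℕ.≤ k
⊔ˡ {m} {n} = ℕP.m⊔n≤o⇒m≤o m n
⊔ʳ : ∀ {m n k} → m ℕ.⊔ n ℕ.≤ k → n ℕ.≤ k
⊔ʳ {m} {n} = ℕP.m⊔n≤o⇒n≤o m n

bounded : ∀ x → ∃₂ λ B N → ℚ.Positive B × (∀ n → N ℕ.≤ n → ℚ.∣ seq x n ∣ ℚ.< B)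
bounded x with cauchy x 1ℚ (ℚP.positive⁻¹ 1ℚ)
... | N , h = ℚ.∣ seq x N ∣ ℚ.+ 1ℚ , N
  , ℚP.nonNeg+pos⇒pos ℚ.∣ seq x N ∣ {{ℚ.nonNegative (ℚP.0≤∣p∣ (seq x N))}} 1ℚ
  , λ n N≤n → Close.bound (seq x N) (seq x n) (h n N N≤n ℕP.≤-refl)

bounded₂ : ∀ x y → ∃₂ λ B N → ℚ.Positive B ×
           (∀ n → N ℕ.≤ n → ℚ.∣ seq x n ∣ ℚ.< B × ℚ.∣ seq y n ∣ ℚ.< B)
bounded₂ x y with bounded x | bounded y
... | B , M , pB , hB | C , N , pC , hC = B ℚ.+ C , M ℕ.⊔ N , ℚP.pos+pos⇒pos B {{pB}} C {{pC}}
  , λ n le → ℚP.<-trans (hB n (⊔ˡ le)) (subst (ℚ._< B ℚ.+ C) (ℚP.+-identityʳ B) (ℚP.+-monoʳ-< B (ℚP.positive⁻¹ C {{pC}})))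
           , ℚP.<-trans (hC n (⊔ʳ {M} le)) (subst (ℚ._< B ℚ.+ C) (ℚP.+-identityˡ C) (ℚP.+-monoˡ-< C (ℚP.positive⁻¹ B {{pB}})))

abstract
  fromℚ-cauchy : ∀ p → Cauchy (λ _ → p)
  fromℚ-cauchy p ε 0<ε = 0 , λ _ _ _ _ → Close.self p 0<ε

fromℚ : ℚ → ℝ
fromℚ p = record { seq = λ _ → p ; cauchy = fromℚ-cauchy p }

abstract
  +ᴿ-cauchy : ∀ x y → Cauchy (λ n → seq x n ℚ.+ seq y n)
  +ᴿ-cauchy x y ε 0<ε =
    let M , p = cauchy x (Close.half ε) (Close.half-pos 0<ε)
        N , q = cauchy y (Close.half ε) (Close.half-pos 0<ε)
    in M ℕ.⊔ N , λ m n lm ln →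
       Close.add (seq x m) (seq x n) (seq y m) (seq y n)
         (p m n (⊔ˡ lm) (⊔ˡ ln)) (q m n (⊔ʳ {M} lm) (⊔ʳ {M} ln))

  -ᴿ-cauchy : ∀ x → Cauchy (λ n → ℚ.- seq x n)
  -ᴿ-cauchy x ε 0<ε = let N , p = cauchy x ε 0<ε in
    N , λ m n lm ln → Close.neg (seq x m) (seq x n) (p m n lm ln)

  *ᴿ-cauchy : ∀ x y → Cauchy (λ n → seq x n ℚ.* seq y n)
  *ᴿ-cauchy x y ε 0<ε =
    let B , K , pB , b = bounded₂ x y
        M , p = cauchy x (Close.tolerance B {{pB}} ε) (Close.tolerance-pos B {{pB}} 0<ε)
        N , q = cauchy y (Close.tolerance B {{pB}} ε) (Close.tolerance-pos B {{pB}} 0<ε)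
    in K ℕ.⊔ (M ℕ.⊔ N) , λ m n lm ln →
       Close.mul B {{pB}} (seq x m) (seq x n) (seq y m) (seq y n)
         (proj₁ (b m (⊔ˡ lm))) (proj₂ (b n (⊔ˡ ln)))
         (p m n (⊔ˡ (⊔ʳ {K} lm)) (⊔ˡ (⊔ʳ {K} ln)))
         (q m n (⊔ʳ {M} (⊔ʳ {K} lm)) (⊔ʳ {M} (⊔ʳ {K} ln)))

infixl 6 _+ᴿ_
infixl 7 _*ᴿ_
infix 8 -ᴿ_

_+ᴿ_ _*ᴿ_ : ℝ → ℝ → ℝ
x +ᴿ y = record { seq = λ n → seq x n ℚ.+ seq y n ; cauchy = +ᴿ-cauchy x y }
x *ᴿ y = record { seq = λ n → seq x n ℚ.* seq y n ; cauchy = *ᴿ-cauchy x y }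

-ᴿ_ : ℝ → ℝ
-ᴿ x = record { seq = λ n → ℚ.- seq x n ; cauchy = -ᴿ-cauchy x }

pointwise : ∀ {x y} → (∀ n → seq x n ≡ seq y n) → x ≈ᴿ y
pointwise {x} {y} h .close ε 0<ε = 0 , λ n _ →
  subst (λ t → ℚ.∣ seq x n ℚ.- t ∣ ℚ.< ε) (h n) (Close.self (seq x n) 0<ε)

≈ᴿ-refl : ∀ {x} → x ≈ᴿ x
≈ᴿ-refl = pointwise λ _ → refl

≈ᴿ-sym : ∀ {x y} → x ≈ᴿ y → y ≈ᴿ x
≈ᴿ-sym {x} {y} e .close ε 0<ε = let N , p = close e ε 0<ε in
  N , λ n le → Close.swap (seq x n) (seq y n) (p n le)

≈ᴿ-trans : ∀ {x y z} → x ≈ᴿ y → y ≈ᴿ z → x ≈ᴿ z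
≈ᴿ-trans {x} {y} {z} e f .close ε 0<ε =
  let M , p = close e _ (Close.half-pos 0<ε)
      N , q = close f _ (Close.half-pos 0<ε)
  in M ℕ.⊔ N , λ n le → Close.chain (seq x n) (seq y n) (seq z n) (p n (⊔ˡ le)) (q n (⊔ʳ {M} le))

+ᴿ-cong : ∀ {x y u v} → x ≈ᴿ y → u ≈ᴿ v → x +ᴿ u ≈ᴿ y +ᴿ v
+ᴿ-cong {x} {y} {u} {v} e f .close ε 0<ε =
  let M , p = close e _ (Close.half-pos 0<ε)
      N , q = close f _ (Close.half-pos 0<ε)
  in M ℕ.⊔ N , λ n le → Close.add (seq x n) (seq y n) (seq u n) (seq v n) (p n (⊔ˡ le)) (q n (⊔ʳ {M} le))

-ᴿ-cong : ∀ {x y} → x ≈ᴿ y → -ᴿ x ≈ᴿ -ᴿ y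
-ᴿ-cong {x} {y} e .close ε 0<ε = let N , p = close e ε 0<ε in
  N , λ n le → Close.neg (seq x n) (seq y n) (p n le)

*ᴿ-cong : ∀ {x y u v} → x ≈ᴿ y → u ≈ᴿ v → x *ᴿ u ≈ᴿ y *ᴿ v
*ᴿ-cong {x} {y} {u} {v} e f .close ε 0<ε =
  let B , K , pB , b = bounded₂ x v
      M , p = close e _ (Close.tolerance-pos B {{pB}} 0<ε)
      N , q = close f _ (Close.tolerance-pos B {{pB}} 0<ε)
  in K ℕ.⊔ (M ℕ.⊔ N) , λ n le →
     Close.mul B {{pB}} (seq x n) (seq y n) (seq u n) (seq v n)
       (proj₁ (b n (⊔ˡ le))) (proj₂ (b n (⊔ˡ le)))
       (p n (⊔ˡ (⊔ʳ {K} le))) (q n (⊔ʳ {M} (⊔ʳ {K} le)))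

ℝ-isCommutativeRing : IsCommutativeRing _≈ᴿ_ _+ᴿ_ _*ᴿ_ -ᴿ_ (fromℚ 0ℚ) (fromℚ 1ℚ)
ℝ-isCommutativeRing = record
  { isRing = record
    { +-isAbelianGroup = record
      { isGroup = record
        { isMonoid = record
          { isSemigroup = record
            { isMagma = record
              { isEquivalence = record { refl = ≈ᴿ-refl ; sym = ≈ᴿ-sym ; trans = ≈ᴿ-trans }
              ; ∙-cong = +ᴿ-cong }
            ; assoc = λ x y z → pointwise λ n → ℚP.+-assoc (seq x n) (seq y n) (seq z n) }
          ; identity = (λ x → pointwise λ n → ℚP.+-identityˡ (seq x n))
                     , (λ x → pointwise λ n → ℚP.+-identityʳ (seq x n)) }
        ; inverse = (λ x → pointwise λ n → ℚP.+-inverseˡ (seq x n))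
                  , (λ x → pointwise λ n → ℚP.+-inverseʳ (seq x n))
        ; ⁻¹-cong = -ᴿ-cong }
      ; comm = λ x y → pointwise λ n → ℚP.+-comm (seq x n) (seq y n) }
    ; *-cong = *ᴿ-cong
    ; *-assoc = λ x y z → pointwise λ n → ℚP.*-assoc (seq x n) (seq y n) (seq z n)
    ; *-identity = (λ x → pointwise λ n → ℚP.*-identityˡ (seq x n))
                 , (λ x → pointwise λ n → ℚP.*-identityʳ (seq x n))
    ; distrib = (λ x y z → pointwise λ n → ℚP.*-distribˡ-+ (seq x n) (seq y n) (seq z n))
              , (λ x y z → pointwise λ n → ℚP.*-distribʳ-+ (seq x n) (seq y n) (seq z n)) }
  ; *-comm = λ x y → pointwise λ n → ℚP.*-comm (seq x n) (seq y n) }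

ℝ-commutativeRing : CommutativeRing 0ℓ 0ℓ
ℝ-commutativeRing = record { isCommutativeRing = ℝ-isCommutativeRing }

isqrt : ℕ → ℕ
isqrt zero    = 0
isqrt (suc n) with suc (isqrt n) ℕ.* suc (isqrt n) ℕ.≤? suc n
... | yes _ = suc (isqrt n)
... | no  _ = isqrt n

isqrt-lower : ∀ n → isqrt n ℕ.* isqrt n ℕ.≤ n
isqrt-lower zero    = ℕ.z≤n
isqrt-lower (suc n) with suc (isqrt n) ℕ.* suc (isqrt n) ℕ.≤? suc n
... | yes p = p
... | no  _ = ℕP.m≤n⇒m≤1+n (isqrt-lower n)

isqrt-upper : ∀ n → n ℕ.< suc (isqrt n) ℕ.* suc (isqrt n)
isqrt-upper zero    = ℕP.≤-refl
isqrt-upper (suc n) with suc (isqrt n) ℕ.* suc (isqrt n) ℕ.≤? suc n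
... | yes _ = ℕP.≤-<-trans (isqrt-upper n) (ℕP.*-mono-< (ℕP.n<1+n (suc (isqrt n))) (ℕP.n<1+n (suc (isqrt n))))
... | no ¬p = ℕP.≰⇒> ¬p

module Fraction where

  open import Data.Rational using (_/_; _+_; _*_; _-_; ∣_∣; _<_; _≤_)

  abstract

    private
      un : ∀ a m → ℚ.toℚᵘ (+ a / suc m) ℚᵘ.≃ ℚᵘ.mkℚᵘ (+ a) m
      un a m = ℚP.toℚᵘ-fromℚᵘ (ℚᵘ.mkℚᵘ (+ a) m)

    less : ∀ a m b n → a ℕ.* suc n ℕ.< b ℕ.* suc m → + a / suc m < + b / suc n
    less a m b n h = ℚP.toℚᵘ-cancel-< (ℚᵘP.<-respˡ-≃ (ℚᵘP.≃-sym (un a m)) (ℚᵘP.<-respʳ-≃ (ℚᵘP.≃-sym (un b n))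
      (ℚᵘ.*<* (subst₂ ℤ._<_ (ℤP.pos-* a (suc n)) (ℤP.pos-* b (suc m)) (ℤ.+<+ h)))))

    leq : ∀ a m b n → a ℕ.* suc n ℕ.≤ b ℕ.* suc m → + a / suc m ≤ + b / suc n
    leq a m b n h = ℚP.toℚᵘ-cancel-≤ (ℚᵘP.≤-respˡ-≃ (ℚᵘP.≃-sym (un a m)) (ℚᵘP.≤-respʳ-≃ (ℚᵘP.≃-sym (un b n))
      (ℚᵘ.*≤* (subst₂ ℤ._≤_ (ℤP.pos-* a (suc n)) (ℤP.pos-* b (suc m)) (ℤ.+≤+ h)))))

    eq : ∀ a m b n → a ℕ.* suc n ≡ b ℕ.* suc m → + a / suc m ≡ + b / suc n
    eq a m b n h = ℚP.≤-antisym (leq a m b n (ℕP.≤-reflexive h)) (leq b n a m (ℕP.≤-reflexive (sym h)))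

    plus : ∀ a m b n → + a / suc m + + b / suc n ≡ + (a ℕ.* suc n ℕ.+ b ℕ.* suc m) / (suc m ℕ.* suc n)
    plus a m b n = ℚP.toℚᵘ-injective (ℚᵘP.≃-trans (ℚP.toℚᵘ-homo-+ (+ a / suc m) (+ b / suc n))
      (ℚᵘP.≃-trans (ℚᵘP.+-cong (un a m) (un b n))
        (ℚᵘP.≃-trans (ℚᵘP.≃-reflexive (cong (λ t → ℚᵘ.mkℚᵘ t (n ℕ.+ m ℕ.* suc n)) (sym (trans (ℤP.pos-+ (a ℕ.* suc n) (b ℕ.* suc m)) (cong₂ ℤ._+_ (ℤP.pos-* a (suc n)) (ℤP.pos-* b (suc m)))))))
          (ℚᵘP.≃-sym (un (a ℕ.* suc n ℕ.+ b ℕ.* suc m) (n ℕ.+ m ℕ.* suc n))))))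

    times : ∀ a m b n → + a / suc m * (+ b / suc n) ≡ + (a ℕ.* b) / (suc m ℕ.* suc n)
    times a m b n = ℚP.toℚᵘ-injective (ℚᵘP.≃-trans (ℚP.toℚᵘ-homo-* (+ a / suc m) (+ b / suc n))
      (ℚᵘP.≃-trans (ℚᵘP.*-cong (un a m) (un b n))
        (ℚᵘP.≃-trans (ℚᵘP.≃-reflexive (cong (λ t → ℚᵘ.mkℚᵘ t (n ℕ.+ m ℕ.* suc n)) (sym (ℤP.pos-* a b))))
          (ℚᵘP.≃-sym (un (a ℕ.* b) (n ℕ.+ m ℕ.* suc n))))))

    archimedean : ∀ c ε → 0ℚ < ε → ∃ λ N → ∀ n → N ℕ.≤ n → + c / suc n ≤ ε
    archimedean c (ℚ.mkℚ (+ zero) d p) 0<ε = contradiction 0<ε (ℚP.<-irrefl (sym (ℚP.↥p≡0⇒p≡0 (ℚ.mkℚ (+ zero) d p) refl)))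
    archimedean c (ℚ.mkℚ -[1+ a ] d p) 0<ε = contradiction (ℚP.drop-*<* 0<ε) λ ()
    archimedean c ε@(ℚ.mkℚ (+ suc a) d p) 0<ε = c ℕ.* suc d , λ n le →
      subst (+ c / suc n ≤_) (ℚP.fromℚᵘ-toℚᵘ ε)
        (leq c n (suc a) d (ℕP.≤-trans (ℕP.m≤n⇒m≤1+n le) (ℕP.m≤m+n (suc n) (a ℕ.* suc n))))

    within : ∀ a b u → a < b + u → b < a + u → ∣ a - b ∣ < u
    within a b u p q with ℚP.∣p∣≡p∨∣p∣≡-p (a - b)
    ... | inj₁ e = subst₂ _<_ (trans (solve 2 (λ a b → a :+ (:- b) := a :- b) refl a b) (sym e))
                     (solve 2 (λ b u → b :+ u :+ (:- b) := u) refl b u) (ℚP.+-monoˡ-< (ℚ.- b) p)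
      where open +-*-Solver using (solve; _:+_; _:-_; :-_; _:=_)
    ... | inj₂ e = subst₂ _<_ (trans (solve 2 (λ a b → b :+ (:- a) := :- (a :- b)) refl a b) (sym e))
                     (solve 2 (λ b u → b :+ u :+ (:- b) := u) refl a u) (ℚP.+-monoˡ-< (ℚ.- a) q)
      where open +-*-Solver using (solve; _:+_; _:-_; :-_; _:=_)

-- The n-th approximation of √ k is ⌊ √ (k (n + 1)²) ⌋ / (n + 1) ≥ 0.
√ℕ-seq : ℕ → ℕ → ℚ
√ℕ-seq k n = + isqrt (k ℕ.* (suc n ℕ.* suc n)) ℚ./ suc n

abstract
  private
    sq-cancel : ∀ a b → a ℕ.* a ℕ.< b ℕ.* b → a ℕ.< b
    sq-cancel a b h with a ℕ.<? b
    ... | yes p = p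
    ... | no ¬p = contradiction (ℕP.*-mono-≤ (ℕP.≮⇒≥ ¬p) (ℕP.≮⇒≥ ¬p)) (ℕP.<⇒≱ h)

    cross : ∀ k f g M N .{{_ : ℕ.NonZero M}} → f ℕ.* f ℕ.≤ k ℕ.* (M ℕ.* M) →
            k ℕ.* (N ℕ.* N) ℕ.< suc g ℕ.* suc g → f ℕ.* N ℕ.< suc g ℕ.* M
    cross k f g M N p q = sq-cancel (f ℕ.* N) (suc g ℕ.* M) (begin-strict
      (f ℕ.* N) ℕ.* (f ℕ.* N)              ≡⟨ solve 2 (λ f n → (f :* n) :* (f :* n) := (f :* f) :* (n :* n)) refl f N ⟩
      (f ℕ.* f) ℕ.* (N ℕ.* N)              ≤⟨ ℕP.*-monoˡ-≤ (N ℕ.* N) p ⟩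
      k ℕ.* (M ℕ.* M) ℕ.* (N ℕ.* N)        ≡⟨ solve 3 (λ k m n → k :* (m :* m) :* (n :* n) := k :* (n :* n) :* (m :* m)) refl k M N ⟩
      k ℕ.* (N ℕ.* N) ℕ.* (M ℕ.* M)        <⟨ ℕP.*-monoˡ-< (M ℕ.* M) {{ℕP.m*n≢0 M M}} q ⟩
      (suc g ℕ.* suc g) ℕ.* (M ℕ.* M)      ≡⟨ solve 2 (λ f n → (f :* f) :* (n :* n) := (f :* n) :* (f :* n)) refl (suc g) M ⟩
      (suc g ℕ.* M) ℕ.* (suc g ℕ.* M)      ∎)
      where
      open ℕP.≤-Reasoning
      open ℕ-Solver using (solve; _:*_; _:=_)

    shift : ∀ g n → + g ℚ./ suc n ℚ.+ + 1 ℚ./ suc n ≡ + suc g ℚ./ suc n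
    shift g n = trans (Fraction.plus g n 1 n) (Fraction.eq (g ℕ.* suc n ℕ.+ 1 ℕ.* suc n) (n ℕ.+ n ℕ.* suc n) (suc g) n
        (solve 2 (λ g n → (g :* n :+ con 1 :* n) :* n := (con 1 :+ g) :* (n :* n)) refl g (suc n)))
      where open ℕ-Solver using (solve; _:*_; _:+_; _:=_; con)

    near : ∀ k f g m n → f ℕ.* f ℕ.≤ k ℕ.* (suc m ℕ.* suc m) → k ℕ.* (suc n ℕ.* suc n) ℕ.< suc g ℕ.* suc g →
           + f ℚ./ suc m ℚ.< + g ℚ./ suc n ℚ.+ + 1 ℚ./ suc n
    near k f g m n p q = subst (+ f ℚ./ suc m ℚ.<_) (sym (shift g n))
      (Fraction.less f m (suc g) n (cross k f g (suc m) (suc n) p q))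

    √ℕ-near : ∀ k m n → √ℕ-seq k m ℚ.< √ℕ-seq k n ℚ.+ + 1 ℚ./ suc n
    √ℕ-near k m n = near k (isqrt (k ℕ.* (suc m ℕ.* suc m))) (isqrt (k ℕ.* (suc n ℕ.* suc n))) m n
      (isqrt-lower (k ℕ.* (suc m ℕ.* suc m))) (isqrt-upper (k ℕ.* (suc n ℕ.* suc n)))

  √ℕ-cauchy : ∀ k → Cauchy (√ℕ-seq k)
  √ℕ-cauchy k ε 0<ε = let N , h = Fraction.archimedean 1 ε 0<ε in
    N , λ m n lm ln → Fraction.within (√ℕ-seq k m) (√ℕ-seq k n) ε
      (ℚP.<-≤-trans (√ℕ-near k m n) (ℚP.+-monoʳ-≤ (√ℕ-seq k n) (h n ln)))
      (ℚP.<-≤-trans (√ℕ-near k n m) (ℚP.+-monoʳ-≤ (√ℕ-seq k m) (h m lm)))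

√ℕ : ℕ → ℝ
√ℕ k = record { seq = √ℕ-seq k ; cauchy = √ℕ-cauchy k }

-- The nonnegative square root of a / b, computed as √ (a * b) / b.
√_/_ : ∀ a b → .{{ℕ.NonZero b}} → ℝ
√ a / b = fromℚ (+ 1 ℚ./ b) *ᴿ √ℕ (a ℕ.* b)

abstract
  private
    k≤k² : ∀ k → k ℕ.≤ k ℕ.* k
    k≤k² zero    = ℕ.z≤n
    k≤k² (suc k) = ℕP.m≤m*n (suc k) (suc k)

    f≤kN : ∀ k f N → f ℕ.* f ℕ.≤ k ℕ.* (N ℕ.* N) → f ℕ.≤ k ℕ.* N
    f≤kN k f N h with f ℕ.≤? k ℕ.* N
    ... | yes p = p
    ... | no ¬p = contradiction
      (ℕP.≤-trans h (ℕP.≤-trans (ℕP.*-monoˡ-≤ (N ℕ.* N) (k≤k² k))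
        (ℕP.≤-reflexive (solve 2 (λ k n → k :* k :* (n :* n) := (k :* n) :* (k :* n)) refl k N))))
      (ℕP.<⇒≱ (ℕP.*-mono-< (ℕP.≰⇒> ¬p) (ℕP.≰⇒> ¬p)))
      where open ℕ-Solver using (solve; _:*_; _:=_)

    square-bound : ∀ k f N .{{_ : ℕ.NonZero N}} → f ℕ.* f ℕ.≤ k ℕ.* (N ℕ.* N) →
      k ℕ.* (N ℕ.* N) ℕ.< suc f ℕ.* suc f → k ℕ.* (N ℕ.* N) ℕ.< f ℕ.* f ℕ.+ (2 ℕ.* k ℕ.+ 1) ℕ.* N
    square-bound k f N p q = begin-strict
      k ℕ.* (N ℕ.* N)                           <⟨ q ⟩
      suc f ℕ.* suc f                           ≡⟨ solve 1 (λ f → (con 1 :+ f) :* (con 1 :+ f) := f :* f :+ (con 2 :* f :+ con 1)) refl f ⟩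
      f ℕ.* f ℕ.+ (2 ℕ.* f ℕ.+ 1)               ≤⟨ ℕP.+-monoʳ-≤ (f ℕ.* f) (ℕP.+-mono-≤ (ℕP.*-monoʳ-≤ 2 (f≤kN k f N p)) (ℕ.>-nonZero⁻¹ N)) ⟩
      f ℕ.* f ℕ.+ (2 ℕ.* (k ℕ.* N) ℕ.+ N)       ≡⟨ solve 3 (λ f k n → f :* f :+ (con 2 :* (k :* n) :+ n) := f :* f :+ (con 2 :* k :+ con 1) :* n) refl f k N ⟩
      f ℕ.* f ℕ.+ (2 ℕ.* k ℕ.+ 1) ℕ.* N         ∎
      where
      open ℕP.≤-Reasoning
      open ℕ-Solver using (solve; _:*_; _:+_; _:=_; con)

    lower : ∀ k f n → f ℕ.* f ℕ.≤ k ℕ.* (suc n ℕ.* suc n) → + f ℚ./ suc n ℚ.* (+ f ℚ./ suc n) ℚ.≤ + k ℚ./ 1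
    lower k f n p = subst (ℚ._≤ + k ℚ./ 1) (sym (Fraction.times f n f n))
      (Fraction.leq (f ℕ.* f) (n ℕ.+ n ℕ.* suc n) k 0
        (subst (ℕ._≤ k ℕ.* (suc n ℕ.* suc n)) (sym (ℕP.*-identityʳ (f ℕ.* f))) p))

    slack : ∀ f C n → + f ℚ./ suc n ℚ.* (+ f ℚ./ suc n) ℚ.+ + C ℚ./ suc n ≡ + (f ℕ.* f ℕ.+ C ℕ.* suc n) ℚ./ (suc n ℕ.* suc n)
    slack f C n = trans (cong (ℚ._+ + C ℚ./ suc n) (Fraction.times f n f n))
      (trans (Fraction.plus (f ℕ.* f) (n ℕ.+ n ℕ.* suc n) C n)
        (Fraction.eq (f ℕ.* f ℕ.* suc n ℕ.+ C ℕ.* (suc n ℕ.* suc n)) (n ℕ.+ (n ℕ.+ n ℕ.* suc n) ℕ.* suc n) (f ℕ.* f ℕ.+ C ℕ.* suc n) (n ℕ.+ n ℕ.* suc n)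
          (solve 3 (λ f c n → (f :* f :* n :+ c :* (n :* n)) :* (n :* n) := (f :* f :+ c :* n) :* ((n :* n) :* n)) refl f C (suc n))))
      where open ℕ-Solver using (solve; _:*_; _:+_; _:=_)

    upper : ∀ k f n → f ℕ.* f ℕ.≤ k ℕ.* (suc n ℕ.* suc n) → k ℕ.* (suc n ℕ.* suc n) ℕ.< suc f ℕ.* suc f →
            + k ℚ./ 1 ℚ.< + f ℚ./ suc n ℚ.* (+ f ℚ./ suc n) ℚ.+ + (2 ℕ.* k ℕ.+ 1) ℚ./ suc n
    upper k f n p q = subst (+ k ℚ./ 1 ℚ.<_) (sym (slack f (2 ℕ.* k ℕ.+ 1) n))
      (Fraction.less k 0 (f ℕ.* f ℕ.+ (2 ℕ.* k ℕ.+ 1) ℕ.* suc n) (n ℕ.+ n ℕ.* suc n)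
        (subst (k ℕ.* (suc n ℕ.* suc n) ℕ.<_) (sym (ℕP.*-identityʳ (f ℕ.* f ℕ.+ (2 ℕ.* k ℕ.+ 1) ℕ.* suc n))) (square-bound k f (suc n) p q)))

  √ℕ-square : ∀ k → √ℕ k *ᴿ √ℕ k ≈ᴿ fromℚ (+ k ℚ./ 1)
  √ℕ-square k .close ε 0<ε = let N , h = Fraction.archimedean (2 ℕ.* k ℕ.+ 1) ε 0<ε in
    N , λ n le → Fraction.within (√ℕ-seq k n ℚ.* √ℕ-seq k n) (+ k ℚ./ 1) ε
      (ℚP.≤-<-trans (lower k (root n) n (isqrt-lower (arg n)))
        (subst (ℚ._< + k ℚ./ 1 ℚ.+ ε) (ℚP.+-identityʳ (+ k ℚ./ 1)) (ℚP.+-monoʳ-< (+ k ℚ./ 1) 0<ε)))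
      (ℚP.<-≤-trans (upper k (root n) n (isqrt-lower (arg n)) (isqrt-upper (arg n)))
        (ℚP.+-monoʳ-≤ (√ℕ-seq k n ℚ.* √ℕ-seq k n) (h n le)))
    where
    arg root : ℕ → ℕ
    arg n = k ℕ.* (suc n ℕ.* suc n)
    root n = isqrt (arg n)

  √-square : ∀ a b .{{_ : ℕ.NonZero b}} → (√ a / b) *ᴿ (√ a / b) ≈ᴿ fromℚ (+ a ℚ./ b)
  √-square a b@(suc c) =
    ≈ᴿ-trans (pointwise λ n → solve 2 (λ u r → (u :* r) :* (u :* r) := (u :* u) :* (r :* r)) refl
                                (+ 1 ℚ./ b) (√ℕ-seq (a ℕ.* b) n))
      (≈ᴿ-trans (*ᴿ-cong {x = fromℚ (+ 1 ℚ./ b ℚ.* (+ 1 ℚ./ b))} ≈ᴿ-refl (√ℕ-square (a ℕ.* b)))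
        (pointwise λ _ → trans (cong (ℚ._* (+ (a ℕ.* b) ℚ./ 1)) (Fraction.times 1 c 1 c))
          (trans (Fraction.times 1 (c ℕ.+ c ℕ.* b) (a ℕ.* b) 0)
            (Fraction.eq (1 ℕ.* (a ℕ.* b)) (0 ℕ.+ (c ℕ.+ c ℕ.* b) ℕ.* 1) a c
              (ℕ-Solver.solve 2 (λ a b → (ℕ-Solver.con 1 ℕ-Solver.:* (a ℕ-Solver.:* b)) ℕ-Solver.:* b
                 ℕ-Solver.:= a ℕ-Solver.:* ((b ℕ-Solver.:* b) ℕ-Solver.:* ℕ-Solver.con 1)) refl a b)))))
    where open +-*-Solver using (solve; _:*_; _:=_)

infix 5 _+i_
record ℂ : Set where
  constructor _+i_
  field re im : ℝ
open ℂ

infix 4 _≈ᶜ_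
record _≈ᶜ_ (z w : ℂ) : Set where
  field
    re-≈ : re z ≈ᴿ re w
    im-≈ : im z ≈ᴿ im w
open _≈ᶜ_

infixl 6 _+ᶜ_
infixl 7 _*ᶜ_
infix 8 -ᶜ_

_+ᶜ_ _*ᶜ_ : ℂ → ℂ → ℂ
z +ᶜ w = (re z +ᴿ re w) +i (im z +ᴿ im w)
z *ᶜ w = (re z *ᴿ re w +ᴿ -ᴿ (im z *ᴿ im w)) +i (re z *ᴿ im w +ᴿ im z *ᴿ re w)

-ᶜ_ conj : ℂ → ℂ
-ᶜ z   = (-ᴿ re z) +i (-ᴿ im z)
conj z = re z +i (-ᴿ im z)

fromℝ : ℝ → ℂ
fromℝ x = x +i fromℚ 0ℚ

fromℤ : ℤ → ℂ
fromℤ k = fromℝ (fromℚ (k ℚ./ 1))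

𝕚 : ℂ
𝕚 = fromℚ 0ℚ +i fromℚ 1ℚ

private
  module ℝ-ring = CommutativeRing ℝ-commutativeRing
  open +-*-Solver using (solve; _:+_; _:*_; :-_; _:=_; con)

  pointwiseᶜ : ∀ {z w} → (∀ n → seq (re z) n ≡ seq (re w) n) → (∀ n → seq (im z) n ≡ seq (im w) n) → z ≈ᶜ w
  pointwiseᶜ p q = record { re-≈ = pointwise p ; im-≈ = pointwise q }

  ≈ᶜ-refl : ∀ {z} → z ≈ᶜ z
  ≈ᶜ-refl = record { re-≈ = ≈ᴿ-refl ; im-≈ = ≈ᴿ-refl }

  *ᶜ-assoc : ∀ x y z → (x *ᶜ y) *ᶜ z ≈ᶜ x *ᶜ (y *ᶜ z)
  *ᶜ-assoc x y z = pointwiseᶜ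
    (λ n → solve 6 (λ a b c d e f →
      (a :* c :+ (:- (b :* d))) :* e :+ (:- ((a :* d :+ b :* c) :* f)) :=
      a :* (c :* e :+ (:- (d :* f))) :+ (:- (b :* (c :* f :+ d :* e)))) refl
      (seq (re x) n) (seq (im x) n) (seq (re y) n) (seq (im y) n) (seq (re z) n) (seq (im z) n))
    (λ n → solve 6 (λ a b c d e f →
      (a :* c :+ (:- (b :* d))) :* f :+ (a :* d :+ b :* c) :* e :=
      a :* (c :* f :+ d :* e) :+ b :* (c :* e :+ (:- (d :* f)))) refl
      (seq (re x) n) (seq (im x) n) (seq (re y) n) (seq (im y) n) (seq (re z) n) (seq (im z) n))

  *ᶜ-comm : ∀ x y → x *ᶜ y ≈ᶜ y *ᶜ x
  *ᶜ-comm x y = pointwiseᶜ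
    (λ n → solve 4 (λ a b c d → a :* c :+ (:- (b :* d)) := c :* a :+ (:- (d :* b))) refl
      (seq (re x) n) (seq (im x) n) (seq (re y) n) (seq (im y) n))
    (λ n → solve 4 (λ a b c d → a :* d :+ b :* c := c :* b :+ d :* a) refl
      (seq (re x) n) (seq (im x) n) (seq (re y) n) (seq (im y) n))

  *ᶜ-identityˡ : ∀ x → fromℝ (fromℚ 1ℚ) *ᶜ x ≈ᶜ x
  *ᶜ-identityˡ x = pointwiseᶜ
    (λ n → solve 2 (λ a b → con 1ℚ :* a :+ (:- (con 0ℚ :* b)) := a) refl (seq (re x) n) (seq (im x) n))
    (λ n → solve 2 (λ a b → con 1ℚ :* b :+ con 0ℚ :* a := b) refl (seq (re x) n) (seq (im x) n))

  *ᶜ-distribˡ : ∀ x y z → x *ᶜ (y +ᶜ z) ≈ᶜ x *ᶜ y +ᶜ x *ᶜ z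
  *ᶜ-distribˡ x y z = pointwiseᶜ
    (λ n → solve 6 (λ a b c d e f →
      a :* (c :+ e) :+ (:- (b :* (d :+ f))) := (a :* c :+ (:- (b :* d))) :+ (a :* e :+ (:- (b :* f)))) refl
      (seq (re x) n) (seq (im x) n) (seq (re y) n) (seq (im y) n) (seq (re z) n) (seq (im z) n))
    (λ n → solve 6 (λ a b c d e f →
      a :* (d :+ f) :+ b :* (c :+ e) := (a :* d :+ b :* c) :+ (a :* f :+ b :* e)) refl
      (seq (re x) n) (seq (im x) n) (seq (re y) n) (seq (im y) n) (seq (re z) n) (seq (im z) n))

  *ᶜ-cong : ∀ {x y u v} → x ≈ᶜ y → u ≈ᶜ v → x *ᶜ u ≈ᶜ y *ᶜ v
  *ᶜ-cong {x} {y} {u} {v} e f = record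
    { re-≈ = +ᴿ-cong {re x *ᴿ re u} {re y *ᴿ re v} { -ᴿ (im x *ᴿ im u)} { -ᴿ (im y *ᴿ im v)}
        (*ᴿ-cong (re-≈ e) (re-≈ f)) (-ᴿ-cong {im x *ᴿ im u} {im y *ᴿ im v} (*ᴿ-cong (im-≈ e) (im-≈ f)))
    ; im-≈ = +ᴿ-cong {re x *ᴿ im u} {re y *ᴿ im v} {im x *ᴿ re u} {im y *ᴿ re v}
        (*ᴿ-cong (re-≈ e) (im-≈ f)) (*ᴿ-cong (im-≈ e) (re-≈ f)) }

  +ᶜ-cong : ∀ {x y u v} → x ≈ᶜ y → u ≈ᶜ v → x +ᶜ u ≈ᶜ y +ᶜ v
  +ᶜ-cong e f = record { re-≈ = +ᴿ-cong (re-≈ e) (re-≈ f) ; im-≈ = +ᴿ-cong (im-≈ e) (im-≈ f) }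

  ≈ᶜ-trans : ∀ {x y z} → x ≈ᶜ y → y ≈ᶜ z → x ≈ᶜ z
  ≈ᶜ-trans e f = record { re-≈ = ≈ᴿ-trans (re-≈ e) (re-≈ f) ; im-≈ = ≈ᴿ-trans (im-≈ e) (im-≈ f) }

ℂ-isCommutativeRing : IsCommutativeRing _≈ᶜ_ _+ᶜ_ _*ᶜ_ -ᶜ_ (fromℝ (fromℚ 0ℚ)) (fromℝ (fromℚ 1ℚ))
ℂ-isCommutativeRing = record
  { isRing = record
    { +-isAbelianGroup = record
      { isGroup = record
        { isMonoid = record
          { isSemigroup = record
            { isMagma = record
              { isEquivalence = record
                { refl  = ≈ᶜ-refl
                ; sym   = λ e → record { re-≈ = ≈ᴿ-sym (re-≈ e) ; im-≈ = ≈ᴿ-sym (im-≈ e) }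
                ; trans = ≈ᶜ-trans }
              ; ∙-cong = +ᶜ-cong }
            ; assoc = λ x y z → record
                { re-≈ = ℝ-ring.+-assoc (re x) (re y) (re z) ; im-≈ = ℝ-ring.+-assoc (im x) (im y) (im z) } }
          ; identity = (λ x → record { re-≈ = ℝ-ring.+-identityˡ (re x) ; im-≈ = ℝ-ring.+-identityˡ (im x) })
                     , (λ x → record { re-≈ = ℝ-ring.+-identityʳ (re x) ; im-≈ = ℝ-ring.+-identityʳ (im x) }) }
        ; inverse = (λ x → record { re-≈ = ℝ-ring.-‿inverseˡ (re x) ; im-≈ = ℝ-ring.-‿inverseˡ (im x) })
                  , (λ x → record { re-≈ = ℝ-ring.-‿inverseʳ (re x) ; im-≈ = ℝ-ring.-‿inverseʳ (im x) })
        ; ⁻¹-cong = λ e → record { re-≈ = -ᴿ-cong (re-≈ e) ; im-≈ = -ᴿ-cong (im-≈ e) } }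
      ; comm = λ x y → record { re-≈ = ℝ-ring.+-comm (re x) (re y) ; im-≈ = ℝ-ring.+-comm (im x) (im y) } }
    ; *-cong = *ᶜ-cong
    ; *-assoc = *ᶜ-assoc
    ; *-identity = *ᶜ-identityˡ , λ x → ≈ᶜ-trans (*ᶜ-comm x (fromℝ (fromℚ 1ℚ))) (*ᶜ-identityˡ x)
    ; distrib = *ᶜ-distribˡ , λ x y z → ≈ᶜ-trans (*ᶜ-comm (y +ᶜ z) x)
        (≈ᶜ-trans (*ᶜ-distribˡ x y z) (+ᶜ-cong (*ᶜ-comm x y) (*ᶜ-comm x z))) }
  ; *-comm = *ᶜ-comm }

ℂ-commutativeRing : CommutativeRing 0ℓ 0ℓ
ℂ-commutativeRing = record { isCommutativeRing = ℂ-isCommutativeRing }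

module Matrices {c ℓ} (R : CommutativeRing c ℓ) where

  open CommutativeRing R hiding (zero; refl; sym; trans)
  private module ≈ = CommutativeRing R using (refl; sym; trans)
  open import Algebra.Properties.Semiring.Sum semiring public
    using (sum; sum-syntax; sum-cong-≋; ∑-distrib-+; ∑-comm; *-distribˡ-sum; *-distribʳ-sum)

  Matrix : ℕ → ℕ → Set c
  Matrix m n = Fin m → Fin n → Carrier

  infix  4 _≋_
  infixl 6 _⊕_ _⊖_
  infixl 7 _·_ _⊗_
  infixr 7 _•_
  infix  9 _ᵀ

  _≋_ : ∀ {m n} → Matrix m n → Matrix m n → Set ℓ
  A ≋ B = ∀ x y → A x y ≈ B x y

  𝐈 : ∀ {n} → Matrix n n
  𝐈 x y = if does (x Fin.≟ y) then 1# else 0#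

  𝐉 : ∀ {m n} → Matrix m n
  𝐉 x y = 1#

  _⊕_ _⊖_ : ∀ {m n} → Matrix m n → Matrix m n → Matrix m n
  (A ⊕ B) x y = A x y + B x y
  (A ⊖ B) x y = A x y - B x y

  _•_ : ∀ {m n} → Carrier → Matrix m n → Matrix m n
  (a • A) x y = a * A x y

  _ᵀ : ∀ {m n} → Matrix m n → Matrix n m
  (A ᵀ) x y = A y x

  _·_ : ∀ {l m n} → Matrix l m → Matrix m n → Matrix l n
  (A · B) x y = ∑[ z < _ ] (A x z * B z y)

  combination : ∀ {r m n} → (Fin r → Carrier) → (Fin r → Matrix m n) → Matrix m n
  combination {r} a A x y = ∑[ k < r ] (a k * A k x y)

  -- Kronecker product: rows and columns are pairs in lexicographic order.
  _⊗_ : ∀ {m n m′ n′} → Matrix m n → Matrix m′ n′ → Matrix (m ℕ.* m′) (n ℕ.* n′)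
  _⊗_ {m} {n} {m′} {n′} A B x y =
    A (quotient {m} m′ x) (quotient {n} n′ y) * B (remainder {m} m′ x) (remainder {n} n′ y)

  abstract

    sum-δ : ∀ {n} (x : Fin n) (f : Fin n → Carrier) → ∑[ z < n ] (𝐈 x z * f z) ≈ f x
    sum-δ {suc n} zero f = ≈.trans (+-cong (*-identityˡ (f zero)) (zeros n (f ∘ suc))) (+-identityʳ (f zero))
      where
      zeros : ∀ n (g : Fin n → Carrier) → ∑[ z < n ] (0# * g z) ≈ 0#
      zeros zero    g = ≈.refl
      zeros (suc n) g = ≈.trans (+-cong (zeroˡ (g zero)) (zeros n (g ∘ suc))) (+-identityˡ 0#)
    sum-δ {suc n} (suc x) f = ≈.trans (+-cong (zeroˡ (f zero)) (sum-δ x (f ∘ suc))) (+-identityˡ (f (suc x)))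

    sum-↑ : ∀ m {n} (f : Fin (m ℕ.+ n) → Carrier) →
            sum f ≈ ∑[ i < m ] f (i ↑ˡ n) + ∑[ j < n ] f (m ↑ʳ j)
    sum-↑ zero    f = ≈.sym (+-identityˡ (sum f))
    sum-↑ (suc m) {n} f = ≈.trans (+-congˡ (sum-↑ m (f ∘ suc))) (≈.sym (+-assoc (f zero) (∑[ i < m ] f (suc (i ↑ˡ n))) (∑[ j < n ] f (suc (m ↑ʳ j)))))

    sum-combine : ∀ m {n} (f : Fin (m ℕ.* n) → Carrier) →
                  sum f ≈ ∑[ i < m ] ∑[ j < n ] f (combine i j)
    sum-combine zero    f = ≈.refl
    sum-combine (suc m) {n} f = ≈.trans (sum-↑ n f) (+-congˡ (sum-combine m (λ k → f (n ↑ʳ k))))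

    sum-remQuot : ∀ m n (f : Fin m → Carrier) (g : Fin n → Carrier) →
                  ∑[ k < m ℕ.* n ] (f (quotient {m} n k) * g (remainder {m} n k)) ≈ sum f * sum g
    sum-remQuot m n f g = ≈.trans (sum-combine m (λ k → f (quotient {m} n k) * g (remainder {m} n k)))
      (≈.trans (sum-cong-≋ λ i → ≈.trans (sum-cong-≋ λ j → reflexive
          (cong (λ p → f (proj₁ p) * g (proj₂ p)) (Fin.remQuot-combine {m} {n} i j)))
        (≈.sym (*-distribˡ-sum (f i) g)))
      (≈.sym (*-distribʳ-sum (sum g) f)))

    interchange : ∀ a b c d → (a * b) * (c * d) ≈ (a * c) * (b * d)
    interchange = Algebra.Properties.CommutativeSemigroup.interchange *-commutativeSemigroup

    ⊗-· : ∀ {l m n l′ m′ n′} (A : Matrix l m) (B : Matrix l′ m′) (C : Matrix m n) (D : Matrix m′ n′) →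
          (A ⊗ B) · (C ⊗ D) ≋ (A · C) ⊗ (B · D)
    ⊗-· {l} {m} {n} {l′} {m′} {n′} A B C D x y =
      go (quotient {l} l′ x) (quotient {n} n′ y) (remainder {l} l′ x) (remainder {n} n′ y)
      where
      go : ∀ x₁ y₁ x₂ y₂ →
        ∑[ z < m ℕ.* m′ ] ((A x₁ (quotient {m} m′ z) * B x₂ (remainder {m} m′ z)) *
                           (C (quotient {m} m′ z) y₁ * D (remainder {m} m′ z) y₂)) ≈
        (A · C) x₁ y₁ * (B · D) x₂ y₂
      go x₁ y₁ x₂ y₂ = ≈.trans
        (sum-cong-≋ {m ℕ.* m′} λ z → interchange (A x₁ (quotient {m} m′ z)) (B x₂ (remainder {m} m′ z))
                                                 (C (quotient {m} m′ z) y₁) (D (remainder {m} m′ z) y₂))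
        (sum-remQuot m m′ (λ z → A x₁ z * C z y₁) (λ z → B x₂ z * D z y₂))

    𝐈⊗𝐈 : ∀ {m n} → 𝐈 {m} ⊗ 𝐈 {n} ≋ 𝐈
    𝐈⊗𝐈 {m} {n} x y = by-cases (quotient {m} n x Fin.≟ quotient {m} n y) (remainder {m} n x Fin.≟ remainder {m} n y) (x Fin.≟ y)
      where
      joint : quotient {m} n x ≡ quotient {m} n y → remainder {m} n x ≡ remainder {m} n y → x ≡ y
      joint p q = trans (sym (Fin.combine-remQuot {m} n x))
        (trans (cong₂ (combine {m} {n}) p q) (Fin.combine-remQuot {m} n y))
      by-cases : (p : Dec (quotient {m} n x ≡ quotient {m} n y)) (q : Dec (remainder {m} n x ≡ remainder {m} n y))
                 (r : Dec (x ≡ y)) →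
                 (if does p then 1# else 0#) * (if does q then 1# else 0#) ≈ (if does r then 1# else 0#)
      by-cases (yes p) (yes q) (yes r) = *-identityˡ 1#
      by-cases (yes p) (yes q) (no ¬r) = contradiction (joint p q) ¬r
      by-cases (no ¬p) q (yes r) = contradiction (cong (quotient {m} n) r) ¬p
      by-cases (yes p) (no ¬q) (yes r) = contradiction (cong (remainder {m} n) r) ¬q
      by-cases (no ¬p) q (no ¬r) = zeroˡ (if does q then 1# else 0#)
      by-cases (yes p) (no ¬q) (no ¬r) = zeroʳ 1#

module ℤM = Matrices ℤP.+-*-commutativeRing
module ℂM = Matrices ℂ-commutativeRing

open ℤM using (Matrix; _≋_; 𝐈; 𝐉; _⊕_; _⊖_; _·_; _⊗_; _ᵀ; _•_; combination; sum-syntax)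

ZeroOne : ∀ {m n} → Matrix m n → Set
ZeroOne A = ∀ x y → A x y ≡ + 0 ⊎ A x y ≡ + 1

-- A scheme on n points with r relations, given by its adjacency matrices Aₖ = adj k;
-- p i j k is the intersection number in Aᵢ Aⱼ = Σₖ pᵢⱼᵏ Aₖ.
record CommutativeAssociationScheme (n r : ℕ) : Set where
  field
    adj         : Fin r → Matrix n n
    zeroOne     : ∀ k → ZeroOne (adj k)
    nonzero     : ∀ k → ∃₂ λ x y → adj k x y ≡ + 1
    identity    : ∃ λ k → adj k ≋ 𝐈
    partition   : ∀ x y → ∑[ k < r ] adj k x y ≡ + 1
    transposed  : ∀ k → ∃ λ k′ → adj k ᵀ ≋ adj k′
    p           : Fin r → Fin r → Fin r → ℕ
    product     : ∀ i j → adj i · adj j ≋ combination (λ k → + p i j k) adj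
    commutative : ∀ i j → adj i · adj j ≋ adj j · adj i
open CommutativeAssociationScheme

zero-one-* : ∀ {a b} → a ≡ + 0 ⊎ a ≡ + 1 → b ≡ + 0 ⊎ b ≡ + 1 → a ℤ.* b ≡ + 0 ⊎ a ℤ.* b ≡ + 1
zero-one-* (inj₁ refl) q          = inj₁ refl
zero-one-* (inj₂ refl) (inj₁ refl) = inj₁ refl
zero-one-* (inj₂ refl) (inj₂ refl) = inj₂ refl

module _ {n r n′ r′} (S : CommutativeAssociationScheme n r) (T : CommutativeAssociationScheme n′ r′) where

  private
    k₁ : Fin (r ℕ.* r′) → Fin r
    k₁ = quotient {r} r′
    k₂ : Fin (r ℕ.* r′) → Fin r′
    k₂ = remainder {r} r′
    x₁ : Fin (n ℕ.* n′) → Fin n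
    x₁ = quotient {n} n′
    x₂ : Fin (n ℕ.* n′) → Fin n′
    x₂ = remainder {n} n′

    adj-⊠ : Fin (r ℕ.* r′) → Matrix (n ℕ.* n′) (n ℕ.* n′)
    adj-⊠ k = adj S (k₁ k) ⊗ adj T (k₂ k)

    adj-combine : ∀ i i′ → adj-⊠ (combine i i′) ≋ adj S i ⊗ adj T i′
    adj-combine i i′ x y = cong (λ (a , b) → (adj S a ⊗ adj T b) x y) (Fin.remQuot-combine i i′)

    at-combine : ∀ i i′ x x′ y y′ →
      (adj S i ⊗ adj T i′) (combine x x′) (combine y y′) ≡ adj S i x y ℤ.* adj T i′ x′ y′
    at-combine i i′ x x′ y y′ = cong₂ (λ (a , a′) (b , b′) → adj S i a b ℤ.* adj T i′ a′ b′)
      (Fin.remQuot-combine x x′) (Fin.remQuot-combine y y′)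

    product-⊠ : ∀ i j → adj-⊠ i · adj-⊠ j ≋
                combination (λ k → + (p S (k₁ i) (k₁ j) (k₁ k) ℕ.* p T (k₂ i) (k₂ j) (k₂ k))) adj-⊠
    product-⊠ i j x y = begin
      (adj-⊠ i · adj-⊠ j) x y
        ≡⟨ ℤM.⊗-· (adj S (k₁ i)) (adj T (k₂ i)) (adj S (k₁ j)) (adj T (k₂ j)) x y ⟩
      (adj S (k₁ i) · adj S (k₁ j)) (x₁ x) (x₁ y) ℤ.* (adj T (k₂ i) · adj T (k₂ j)) (x₂ x) (x₂ y)
        ≡⟨ cong₂ ℤ._*_ (product S (k₁ i) (k₁ j) (x₁ x) (x₁ y)) (product T (k₂ i) (k₂ j) (x₂ x) (x₂ y)) ⟩
      ∑[ k < r ] f k ℤ.* ∑[ k < r′ ] g k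
        ≡⟨ ℤM.sum-remQuot r r′ f g ⟨
      ∑[ k < r ℕ.* r′ ] (f (k₁ k) ℤ.* g (k₂ k))
        ≡⟨ ℤM.sum-cong-≋ {r ℕ.* r′} (λ k → regroup (p S (k₁ i) (k₁ j) (k₁ k)) (adj S (k₁ k) (x₁ x) (x₁ y))
                                    (p T (k₂ i) (k₂ j) (k₂ k)) (adj T (k₂ k) (x₂ x) (x₂ y))) ⟩
      combination (λ k → + (p S (k₁ i) (k₁ j) (k₁ k) ℕ.* p T (k₂ i) (k₂ j) (k₂ k))) adj-⊠ x y ∎
      where
      open ≡-Reasoning
      f : Fin r → ℤ
      f k = + p S (k₁ i) (k₁ j) k ℤ.* adj S k (x₁ x) (x₁ y)
      g : Fin r′ → ℤ
      g k = + p T (k₂ i) (k₂ j) k ℤ.* adj T k (x₂ x) (x₂ y)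
      regroup : ∀ a b c d → (+ a ℤ.* b) ℤ.* (+ c ℤ.* d) ≡ + (a ℕ.* c) ℤ.* (b ℤ.* d)
      regroup a b c d = trans (ℤM.interchange (+ a) b (+ c) d) (cong (ℤ._* (b ℤ.* d)) (sym (ℤP.pos-* a c)))

  -- Tensor product: its adjacency matrices are the Aᵢ ⊗ Bⱼ, the pair (i , j) being coded in Fin (r * r′).
  infixr 7 _⊠_
  _⊠_ : CommutativeAssociationScheme (n ℕ.* n′) (r ℕ.* r′)
  _⊠_ = record
    { adj         = adj-⊠
    ; zeroOne     = λ k x y → zero-one-* (zeroOne S (k₁ k) (x₁ x) (x₁ y)) (zeroOne T (k₂ k) (x₂ x) (x₂ y))
    ; nonzero     = λ k →
        let x , y , e = nonzero S (k₁ k) ; x′ , y′ , e′ = nonzero T (k₂ k) in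
        combine x x′ , combine y y′ ,
        trans (at-combine (k₁ k) (k₂ k) x x′ y y′) (cong₂ ℤ._*_ e e′)
    ; identity    =
        let i , e = identity S ; i′ , e′ = identity T in
        combine i i′ , λ x y → trans (adj-combine i i′ x y)
          (trans (cong₂ ℤ._*_ (e (x₁ x) (x₁ y)) (e′ (x₂ x) (x₂ y))) (ℤM.𝐈⊗𝐈 {n} {n′} x y))
    ; partition   = λ x y →
        trans (ℤM.sum-remQuot r r′ (λ k → adj S k (x₁ x) (x₁ y)) (λ k → adj T k (x₂ x) (x₂ y)))
          (cong₂ ℤ._*_ (partition S (x₁ x) (x₁ y)) (partition T (x₂ x) (x₂ y)))
    ; transposed  = λ k →
        let i , e = transposed S (k₁ k) ; i′ , e′ = transposed T (k₂ k) in
        combine i i′ , λ x y → trans (cong₂ ℤ._*_ (e (x₁ x) (x₁ y)) (e′ (x₂ x) (x₂ y)))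
          (sym (adj-combine i i′ x y))
    ; p           = λ i j k → p S (k₁ i) (k₁ j) (k₁ k) ℕ.* p T (k₂ i) (k₂ j) (k₂ k)
    ; product     = product-⊠
    ; commutative = λ i j x y →
        trans (ℤM.⊗-· (adj S (k₁ i)) (adj T (k₂ i)) (adj S (k₁ j)) (adj T (k₂ j)) x y)
          (trans (cong₂ ℤ._*_ (commutative S (k₁ i) (k₁ j) (x₁ x) (x₁ y)) (commutative T (k₂ i) (k₂ j) (x₂ x) (x₂ y)))
            (sym (ℤM.⊗-· (adj S (k₁ j)) (adj T (k₂ j)) (adj S (k₁ i)) (adj T (k₂ i)) x y)))
    }

point : CommutativeAssociationScheme 1 1
point = record
  { adj         = λ _ → 𝐉
  ; zeroOne     = λ _ _ _ → inj₂ refl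
  ; nonzero     = λ _ → zero , zero , refl
  ; identity    = zero , λ { zero zero → refl }
  ; partition   = λ _ _ → refl
  ; transposed  = λ k → k , λ _ _ → refl
  ; p           = λ _ _ _ → 1
  ; product     = λ _ _ _ _ → refl
  ; commutative = λ _ _ _ _ → refl
  }

-- Adjacency matrices A_{i₁} ⊗ ⋯ ⊗ A_{iₘ}, the tuple (i₁ , … , iₘ) being coded in Fin (r ^ m).
infixr 8 _^⊠_
_^⊠_ : ∀ {n r} → CommutativeAssociationScheme n r → ∀ m → CommutativeAssociationScheme (n ℕ.^ m) (r ℕ.^ m)
S ^⊠ zero  = point
S ^⊠ suc m = S ⊠ (S ^⊠ m)

IsHadamard : ∀ {n} → Matrix n n → Set
IsHadamard {n} H = (∀ x y → H x y ≡ + 1 ⊎ H x y ≡ -1ℤ) × H · H ᵀ ≋ + n • 𝐈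

IsSkewSymmetric : ∀ {n} → Matrix n n → Set
IsSkewSymmetric W = ∀ x y → (W ᵀ) x y ≡ ℤ.- W x y

IsSkewTypeHadamard : ∀ {n} → Matrix n n → Set
IsSkewTypeHadamard {n} H = IsHadamard H × ∃ λ (W : Matrix n n) →
  (∀ x y → W x y ≡ + 0 ⊎ W x y ≡ + 1 ⊎ W x y ≡ -1ℤ) × IsSkewSymmetric W × H ≋ 𝐈 ⊕ W

bordered : ∀ {q} → Matrix q q → Matrix (suc q) (suc q)
bordered Q zero    zero    = + 1
bordered Q zero    (suc y) = + 1
bordered Q (suc x) zero    = -1ℤ
bordered Q (suc x) (suc y) = (𝐈 ⊕ Q) x y

IsSkewSymmetricCore : ∀ {q} → Matrix q q → Set
IsSkewSymmetricCore Q = IsSkewTypeHadamard (bordered Q)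

mutual
  𝒥 𝒜 : ∀ {q} → Matrix q q → ∀ m → Matrix (q ℕ.^ m) (q ℕ.^ m)
  𝒥 Q zero    = 𝐉
  𝒥 {q} Q (suc m) = _⊗_ {q} {q} 𝐉 (𝒜 Q m)
  𝒜 Q zero    = 𝐉
  𝒜 {q} Q (suc m) = _⊗_ {q} {q} 𝐈 (𝒥 Q m) ⊕ _⊗_ {q} {q} Q (𝒜 Q m)

record Splitting {q} (Q A₁ A₂ : Matrix q q) : Set where
  field
    zeroOne₁   : ZeroOne A₁
    zeroOne₂   : ZeroOne A₂
    disjoint   : ∀ x y → ¬ (A₁ x y ≢ + 0 × A₂ x y ≢ + 0)
    difference : Q ≋ A₁ ⊖ A₂
open Splitting

module 𝔛-construction {q} {Q A₁ A₂ : Matrix q q} (core : IsSkewSymmetricCore Q) (split : Splitting Q A₁ A₂) where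

  A : Fin 3 → Matrix q q
  A zero             = 𝐈
  A (suc zero)       = A₁
  A (suc (suc zero)) = A₂

  abstract
    private
      B : Matrix (suc q) (suc q)
      B = bordered Q

    cancelˡ : ∀ a {b c} → a ℤ.+ b ≡ a ℤ.+ c → b ≡ c
    cancelˡ a {b} {c} e = trans (strip a b) (trans (cong (ℤ._+_ (ℤ.- a)) e) (sym (strip a c)))
      where
      strip : ∀ a b → b ≡ ℤ.- a ℤ.+ (a ℤ.+ b)
      strip = solve-∀

    Q-skew : ∀ x y → Q y x ≡ ℤ.- Q x y
    Q-skew x y with proj₂ core
    ... | W , _ , skew , B≋I+W = trans (Q≡W y x) (trans (skew (suc x) (suc y)) (cong ℤ.-_ (sym (Q≡W x y))))
      where
      Q≡W : ∀ x y → Q x y ≡ W (suc x) (suc y)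
      Q≡W x y = cancelˡ (𝐈 x y) (B≋I+W (suc x) (suc y))

    Q-diagonal : ∀ x → Q x x ≡ + 0
    Q-diagonal x = self-neg (Q x x) (Q-skew x x)
      where
      self-neg : ∀ a → a ≡ ℤ.- a → a ≡ + 0
      self-neg (+ zero) _ = refl

    Q-off-diagonal : ∀ x y → x ≢ y → Q x y ≡ + 1 ⊎ Q x y ≡ ℤ.- (+ 1)
    Q-off-diagonal x y x≢y with x Fin.≟ y | proj₁ (proj₁ core) (suc x) (suc y)
    ... | yes x≡y | _ = contradiction x≡y x≢y
    ... | no  _   | inj₁ e = inj₁ (trans (sym (ℤP.+-identityˡ (Q x y))) e)
    ... | no  _   | inj₂ e = inj₂ (trans (sym (ℤP.+-identityˡ (Q x y))) e)

    sum-𝐈 : ∀ {n} (x : Fin n) → ∑[ z < n ] 𝐈 x z ≡ + 1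
    sum-𝐈 {n} x = trans (ℤM.sum-cong-≋ {n} λ z → sym (ℤP.*-identityʳ (𝐈 x z))) (ℤM.sum-δ x (λ _ → + 1))

    sum-1 : ∀ n → ∑[ z < n ] (+ 1) ≡ + n
    sum-1 zero    = refl
    sum-1 (suc n) = cong (ℤ._+_ (+ 1)) (sum-1 n)

    Q-row-sum : ∀ x → ∑[ z < q ] Q x z ≡ + 0
    Q-row-sum x = cancelˡ (+ 1) (trans (cong (ℤ._+ s) (sym (sum-𝐈 x)))
      (trans (sym (ℤM.∑-distrib-+ (𝐈 x) (Q x))) row))
      where
      s : ℤ
      s = ∑[ z < q ] Q x z
      row : ∑[ z < q ] (𝐈 x z ℤ.+ Q x z) ≡ + 1 ℤ.+ + 0
      row = cancelˡ (ℤ.- (+ 1)) (trans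
        (cong (ℤ._+_ (ℤ.- (+ 1))) (ℤM.sum-cong-≋ {q} λ z → sym (ℤP.*-identityʳ (𝐈 x z ℤ.+ Q x z))))
        (trans (proj₂ (proj₁ core) (suc x) zero) (ℤP.*-zeroʳ (+ suc q))))

    Q-col-sum : ∀ y → ∑[ z < q ] Q z y ≡ + 0
    Q-col-sum y = trans (ℤM.sum-cong-≋ {q} λ z → trans (Q-skew y z) (sym (ℤP.-1*i≡-i (Q y z))))
      (trans (sym (ℤM.*-distribˡ-sum (ℤ.- (+ 1)) (Q y))) (trans (cong (ℤ._*_ (ℤ.- (+ 1))) (Q-row-sum y)) (ℤP.*-zeroʳ (ℤ.- (+ 1)))))

    linear : ∀ {n} a b (f g : Fin n → ℤ) →
             ∑[ z < n ] (a ℤ.* f z ℤ.+ b ℤ.* g z) ≡ a ℤ.* ∑[ z < n ] f z ℤ.+ b ℤ.* ∑[ z < n ] g z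
    linear {n} a b f g = trans (ℤM.∑-distrib-+ (λ z → a ℤ.* f z) (λ z → b ℤ.* g z))
      (cong₂ ℤ._+_ (sym (ℤM.*-distribˡ-sum a f)) (sym (ℤM.*-distribˡ-sum b g)))

    𝐈-sym : ∀ {n} (x y : Fin n) → 𝐈 x y ≡ 𝐈 y x
    𝐈-sym x y with x Fin.≟ y | y Fin.≟ x
    ... | yes _ | yes _ = refl
    ... | no  _ | no  _ = refl
    ... | yes p | no ¬p = contradiction (sym p) ¬p
    ... | no ¬p | yes p = contradiction (sym p) ¬p

    -- (I + Q)(I + Q)ᵀ = (q + 1) I - J, expanded using skew symmetry
    QQᵀ : ∀ x y → ∑[ z < q ] (Q x z ℤ.* Q y z) ≡ + q ℤ.* 𝐈 x y ℤ.- + 1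
    QQᵀ x y = isolate s (𝐈 x y) (Q x y) (+ q) (trans (sym expand) (proj₂ (proj₁ core) (suc x) (suc y)))
      where
      s : ℤ
      s = ∑[ z < q ] (Q x z ℤ.* Q y z)
      row : ∑[ z < q ] ((𝐈 x z ℤ.+ Q x z) ℤ.* (𝐈 y z ℤ.+ Q y z)) ≡ (𝐈 x y ℤ.- Q x y) ℤ.+ (Q x y ℤ.+ s)
      row = begin
        ∑[ z < q ] ((𝐈 x z ℤ.+ Q x z) ℤ.* (𝐈 y z ℤ.+ Q y z))
          ≡⟨ ℤM.sum-cong-≋ {q} (λ z → split₄ (𝐈 x z) (Q x z) (𝐈 y z) (Q y z)) ⟩
        ∑[ z < q ] (𝐈 x z ℤ.* (𝐈 y z ℤ.+ Q y z) ℤ.+ (𝐈 y z ℤ.* Q x z ℤ.+ Q x z ℤ.* Q y z))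
          ≡⟨ ℤM.∑-distrib-+ {q} (λ z → 𝐈 x z ℤ.* (𝐈 y z ℤ.+ Q y z)) (λ z → 𝐈 y z ℤ.* Q x z ℤ.+ Q x z ℤ.* Q y z) ⟩
        ∑[ z < q ] (𝐈 x z ℤ.* (𝐈 y z ℤ.+ Q y z)) ℤ.+ ∑[ z < q ] (𝐈 y z ℤ.* Q x z ℤ.+ Q x z ℤ.* Q y z)
          ≡⟨ cong₂ ℤ._+_ (ℤM.sum-δ x (λ z → 𝐈 y z ℤ.+ Q y z))
               (trans (ℤM.∑-distrib-+ {q} (λ z → 𝐈 y z ℤ.* Q x z) (λ z → Q x z ℤ.* Q y z))
                 (cong (ℤ._+ s) (ℤM.sum-δ y (Q x)))) ⟩
        (𝐈 y x ℤ.+ Q y x) ℤ.+ (Q x y ℤ.+ s)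
          ≡⟨ cong (ℤ._+ (Q x y ℤ.+ s)) (cong₂ ℤ._+_ (𝐈-sym y x) (Q-skew x y)) ⟩
        (𝐈 x y ℤ.- Q x y) ℤ.+ (Q x y ℤ.+ s) ∎
        where
        open ≡-Reasoning
        split₄ : ∀ a b c d → (a ℤ.+ b) ℤ.* (c ℤ.+ d) ≡ a ℤ.* (c ℤ.+ d) ℤ.+ (c ℤ.* b ℤ.+ b ℤ.* d)
        split₄ = solve-∀
      expand : (B · B ᵀ) (suc x) (suc y) ≡ + 1 ℤ.+ ((𝐈 x y ℤ.- Q x y) ℤ.+ (Q x y ℤ.+ s))
      expand = cong (ℤ._+_ (+ 1)) row
      isolate : ∀ s d b q → + 1 ℤ.+ ((d ℤ.- b) ℤ.+ (b ℤ.+ s)) ≡ (+ 1 ℤ.+ q) ℤ.* d → s ≡ q ℤ.* d ℤ.- + 1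
      isolate s d b q e = trans (lhs s d b) (trans (cong (λ t → t ℤ.- + 1 ℤ.- d) e) (rhs d q))
        where
        lhs : ∀ s d b → s ≡ (+ 1 ℤ.+ ((d ℤ.- b) ℤ.+ (b ℤ.+ s))) ℤ.- + 1 ℤ.- d
        lhs = solve-∀
        rhs : ∀ d q → (+ 1 ℤ.+ q) ℤ.* d ℤ.- + 1 ℤ.- d ≡ q ℤ.* d ℤ.- + 1
        rhs = solve-∀

    QQ : ∀ x y → ∑[ z < q ] (Q x z ℤ.* Q z y) ≡ + 1 ℤ.- + q ℤ.* 𝐈 x y
    QQ x y = trans (ℤM.sum-cong-≋ {q} λ z → trans (cong (Q x z ℤ.*_) (Q-skew y z)) (neg-mul (Q x z) (Q y z)))
      (trans (sym (ℤM.*-distribˡ-sum (ℤ.- (+ 1)) (λ z → Q x z ℤ.* Q y z)))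
        (trans (cong (ℤ._*_ (ℤ.- (+ 1))) (QQᵀ x y)) (flip-sign (+ q) (𝐈 x y))))
      where
      neg-mul : ∀ a b → a ℤ.* (ℤ.- b) ≡ ℤ.- (+ 1) ℤ.* (a ℤ.* b)
      neg-mul = solve-∀
      flip-sign : ∀ q d → ℤ.- (+ 1) ℤ.* (q ℤ.* d ℤ.- + 1) ≡ + 1 ℤ.- q ℤ.* d
      flip-sign = solve-∀

  -- Coefficients in 2 Aᵢ = αᵢ J + βᵢ I + γᵢ Q; δ and ε are the entries of I and Q on relation k.
  α β γ δ ε : Fin 3 → ℤ
  α zero = + 0
  α (suc _) = + 1
  β zero = + 2
  β (suc _) = ℤ.- (+ 1)
  γ zero = + 0
  γ (suc zero) = + 1
  γ (suc (suc _)) = ℤ.- (+ 1)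
  δ zero = + 1
  δ (suc _) = + 0
  ε = γ

  record Cell (x y : Fin q) (k : Fin 3) : Set where
    constructor mkCell
    field
      A-value : ∀ i → A i x y ≡ 𝐈 i k
      𝐈-value : 𝐈 x y ≡ δ k
      Q-value : Q x y ≡ ε k
  open Cell

  abstract
    cell : ∀ x y → ∃ (Cell x y)
    cell x y = go (x Fin.≟ y)
      where
      values : ∀ a b c → a ≡ + 0 ⊎ a ≡ + 1 → b ≡ + 0 ⊎ b ≡ + 1 → ¬ (a ≢ + 0 × b ≢ + 0) → c ≡ a ℤ.- b →
               (c ≡ + 0 → a ≡ + 0 × b ≡ + 0) × (c ≡ + 1 → a ≡ + 1 × b ≡ + 0) × (c ≡ ℤ.- (+ 1) → a ≡ + 0 × b ≡ + 1)
      values _ _ _ (inj₁ refl) (inj₁ refl) d refl = (λ _ → refl , refl) , (λ ()) , (λ ())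
      values _ _ _ (inj₁ refl) (inj₂ refl) d refl = (λ ()) , (λ ()) , (λ _ → refl , refl)
      values _ _ _ (inj₂ refl) (inj₁ refl) d refl = (λ ()) , (λ _ → refl , refl) , (λ ())
      values _ _ _ (inj₂ refl) (inj₂ refl) d refl = contradiction ((λ ()) , (λ ())) d
      v : (Q x y ≡ + 0 → A₁ x y ≡ + 0 × A₂ x y ≡ + 0) × (Q x y ≡ + 1 → A₁ x y ≡ + 1 × A₂ x y ≡ + 0) ×
          (Q x y ≡ ℤ.- (+ 1) → A₁ x y ≡ + 0 × A₂ x y ≡ + 1)
      v = values (A₁ x y) (A₂ x y) (Q x y) (zeroOne₁ split x y) (zeroOne₂ split x y) (disjoint split x y) (difference split x y)
      on : x ≡ y → 𝐈 x y ≡ + 1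
      on p with x Fin.≟ y
      ... | yes _ = refl
      ... | no ¬p = contradiction p ¬p
      off : x ≢ y → 𝐈 x y ≡ + 0
      off ¬p with x Fin.≟ y
      ... | yes p = contradiction p ¬p
      ... | no _  = refl
      Q0 : x ≡ y → Q x y ≡ + 0
      Q0 refl = Q-diagonal x
      go : Dec (x ≡ y) → ∃ (Cell x y)
      go (yes p) = let a , b = proj₁ v (Q0 p) in
        zero , mkCell (λ { zero → on p ; (suc zero) → a ; (suc (suc zero)) → b }) (on p) (Q0 p)
      go (no ¬p) with Q-off-diagonal x y ¬p
      ... | inj₁ e = let a , b = proj₁ (proj₂ v) e in
        suc zero , mkCell (λ { zero → off ¬p ; (suc zero) → a ; (suc (suc zero)) → b }) (off ¬p) e
      ... | inj₂ e = let a , b = proj₂ (proj₂ v) e in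
        suc (suc zero) , mkCell (λ { zero → off ¬p ; (suc zero) → a ; (suc (suc zero)) → b }) (off ¬p) e

    double : ∀ i x y → + 2 ℤ.* A i x y ≡ α i ℤ.* + 1 ℤ.+ (β i ℤ.* 𝐈 x y ℤ.+ γ i ℤ.* Q x y)
    double i x y with cell x y
    ... | k , c rewrite A-value c i | 𝐈-value c | Q-value c = table i k
      where
      table : ∀ (i k : Fin 3) → + 2 ℤ.* 𝐈 i k ≡ α i ℤ.* + 1 ℤ.+ (β i ℤ.* δ k ℤ.+ γ i ℤ.* ε k)
      table zero zero = refl
      table zero (suc zero) = refl
      table zero (suc (suc zero)) = refl
      table (suc zero) zero = refl
      table (suc zero) (suc zero) = refl
      table (suc zero) (suc (suc zero)) = refl
      table (suc (suc zero)) zero = refl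
      table (suc (suc zero)) (suc zero) = refl
      table (suc (suc zero)) (suc (suc zero)) = refl

    linear₃ : ∀ {n} a b c (f g h : Fin n → ℤ) →
              ∑[ z < n ] (a ℤ.* f z ℤ.+ (b ℤ.* g z ℤ.+ c ℤ.* h z)) ≡
              a ℤ.* ∑[ z < n ] f z ℤ.+ (b ℤ.* ∑[ z < n ] g z ℤ.+ c ℤ.* ∑[ z < n ] h z)
    linear₃ {n} a b c f g h = trans (ℤM.∑-distrib-+ (λ z → a ℤ.* f z) (λ z → b ℤ.* g z ℤ.+ c ℤ.* h z))
      (cong₂ ℤ._+_ (sym (ℤM.*-distribˡ-sum a f)) (linear b c g h))

    weighted : ∀ a b c x (w : Fin q → ℤ) →
               ∑[ z < q ] ((a ℤ.* + 1 ℤ.+ (b ℤ.* 𝐈 x z ℤ.+ c ℤ.* Q x z)) ℤ.* w z) ≡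
               a ℤ.* ∑[ z < q ] w z ℤ.+ (b ℤ.* w x ℤ.+ c ℤ.* ∑[ z < q ] (Q x z ℤ.* w z))
    weighted a b c x w = begin
      ∑[ z < q ] ((a ℤ.* + 1 ℤ.+ (b ℤ.* 𝐈 x z ℤ.+ c ℤ.* Q x z)) ℤ.* w z)
        ≡⟨ ℤM.sum-cong-≋ {q} (λ z → spread a b (𝐈 x z) c (Q x z) (w z)) ⟩
      ∑[ z < q ] (a ℤ.* w z ℤ.+ (b ℤ.* (𝐈 x z ℤ.* w z) ℤ.+ c ℤ.* (Q x z ℤ.* w z)))
        ≡⟨ linear₃ a b c w (λ z → 𝐈 x z ℤ.* w z) (λ z → Q x z ℤ.* w z) ⟩
      a ℤ.* ∑[ z < q ] w z ℤ.+ (b ℤ.* ∑[ z < q ] (𝐈 x z ℤ.* w z) ℤ.+ c ℤ.* ∑[ z < q ] (Q x z ℤ.* w z))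
        ≡⟨ cong (λ t → a ℤ.* ∑[ z < q ] w z ℤ.+ (b ℤ.* t ℤ.+ c ℤ.* ∑[ z < q ] (Q x z ℤ.* w z))) (ℤM.sum-δ x w) ⟩
      a ℤ.* ∑[ z < q ] w z ℤ.+ (b ℤ.* w x ℤ.+ c ℤ.* ∑[ z < q ] (Q x z ℤ.* w z)) ∎
      where
      open ≡-Reasoning
      spread : ∀ a b d c e w → (a ℤ.* + 1 ℤ.+ (b ℤ.* d ℤ.+ c ℤ.* e)) ℤ.* w ≡
               a ℤ.* w ℤ.+ (b ℤ.* (d ℤ.* w) ℤ.+ c ℤ.* (e ℤ.* w))
      spread = solve-∀

    row-weight : ℤ → ℤ → ℤ → Fin q → Fin q → ℤ
    row-weight a b c y z = a ℤ.* + 1 ℤ.+ (b ℤ.* 𝐈 z y ℤ.+ c ℤ.* Q z y)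

    sum-weight : ∀ a b c y → ∑[ z < q ] row-weight a b c y z ≡ a ℤ.* + q ℤ.+ (b ℤ.* + 1 ℤ.+ c ℤ.* + 0)
    sum-weight a b c y = trans (linear₃ a b c (λ _ → + 1) (λ z → 𝐈 z y) (λ z → Q z y))
      (cong₂ (λ s t → a ℤ.* s ℤ.+ t) (sum-1 q) (cong₂ (λ s t → b ℤ.* s ℤ.+ c ℤ.* t)
        (trans (ℤM.sum-cong-≋ {q} λ z → 𝐈-sym z y) (sum-𝐈 y)) (Q-col-sum y)))

    sum-Q-weight : ∀ a b c x y → ∑[ z < q ] (Q x z ℤ.* row-weight a b c y z) ≡
                   a ℤ.* + 0 ℤ.+ (b ℤ.* Q x y ℤ.+ c ℤ.* (+ 1 ℤ.- + q ℤ.* 𝐈 x y))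
    sum-Q-weight a b c x y = begin
      ∑[ z < q ] (Q x z ℤ.* row-weight a b c y z)
        ≡⟨ ℤM.sum-cong-≋ {q} (λ z → trans (push (Q x z) a b (𝐈 z y) c (Q z y))
             (cong (λ t → a ℤ.* Q x z ℤ.+ (b ℤ.* (t ℤ.* Q x z) ℤ.+ c ℤ.* (Q x z ℤ.* Q z y))) (𝐈-sym z y))) ⟩
      ∑[ z < q ] (a ℤ.* Q x z ℤ.+ (b ℤ.* (𝐈 y z ℤ.* Q x z) ℤ.+ c ℤ.* (Q x z ℤ.* Q z y)))
        ≡⟨ linear₃ a b c (Q x) (λ z → 𝐈 y z ℤ.* Q x z) (λ z → Q x z ℤ.* Q z y) ⟩
      a ℤ.* ∑[ z < q ] Q x z ℤ.+ (b ℤ.* ∑[ z < q ] (𝐈 y z ℤ.* Q x z) ℤ.+ c ℤ.* ∑[ z < q ] (Q x z ℤ.* Q z y))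
        ≡⟨ cong₂ (λ s t → a ℤ.* s ℤ.+ t) (Q-row-sum x)
             (cong₂ (λ s t → b ℤ.* s ℤ.+ c ℤ.* t) (ℤM.sum-δ y (Q x)) (QQ x y)) ⟩
      a ℤ.* + 0 ℤ.+ (b ℤ.* Q x y ℤ.+ c ℤ.* (+ 1 ℤ.- + q ℤ.* 𝐈 x y)) ∎
      where
      open ≡-Reasoning
      push : ∀ p a b d c e → p ℤ.* (a ℤ.* + 1 ℤ.+ (b ℤ.* d ℤ.+ c ℤ.* e)) ≡
             a ℤ.* p ℤ.+ (b ℤ.* (d ℤ.* p) ℤ.+ c ℤ.* (p ℤ.* e))
      push = solve-∀

    product-value : (a b c a′ b′ c′ d e : ℤ) → ℤ
    product-value a b c a′ b′ c′ d e =
      a ℤ.* (a′ ℤ.* + q ℤ.+ (b′ ℤ.* + 1 ℤ.+ c′ ℤ.* + 0)) ℤ.+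
      (b ℤ.* (a′ ℤ.* + 1 ℤ.+ (b′ ℤ.* d ℤ.+ c′ ℤ.* e)) ℤ.+
       c ℤ.* (a′ ℤ.* + 0 ℤ.+ (b′ ℤ.* e ℤ.+ c′ ℤ.* (+ 1 ℤ.- + q ℤ.* d))))

    double-product : ∀ i j x y → + 2 ℤ.* (+ 2 ℤ.* (A i · A j) x y) ≡
      product-value (α i) (β i) (γ i) (α j) (β j) (γ j) (𝐈 x y) (Q x y)
    double-product i j x y = begin
      + 2 ℤ.* (+ 2 ℤ.* (A i · A j) x y)
        ≡⟨ cong (+ 2 ℤ.*_) (ℤM.*-distribˡ-sum (+ 2) (λ z → A i x z ℤ.* A j z y)) ⟩
      + 2 ℤ.* ∑[ z < q ] (+ 2 ℤ.* (A i x z ℤ.* A j z y))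
        ≡⟨ ℤM.*-distribˡ-sum (+ 2) (λ z → + 2 ℤ.* (A i x z ℤ.* A j z y)) ⟩
      ∑[ z < q ] (+ 2 ℤ.* (+ 2 ℤ.* (A i x z ℤ.* A j z y)))
        ≡⟨ ℤM.sum-cong-≋ {q} (λ z → trans (pair (+ 2) (A i x z) (A j z y)) (cong₂ ℤ._*_ (double i x z) (double j z y))) ⟩
      ∑[ z < q ] ((α i ℤ.* + 1 ℤ.+ (β i ℤ.* 𝐈 x z ℤ.+ γ i ℤ.* Q x z)) ℤ.* w z)
        ≡⟨ weighted (α i) (β i) (γ i) x w ⟩
      α i ℤ.* ∑[ z < q ] w z ℤ.+ (β i ℤ.* w x ℤ.+ γ i ℤ.* ∑[ z < q ] (Q x z ℤ.* w z))
        ≡⟨ cong₂ (λ s t → α i ℤ.* s ℤ.+ (β i ℤ.* w x ℤ.+ γ i ℤ.* t))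
             (sum-weight (α j) (β j) (γ j) y) (sum-Q-weight (α j) (β j) (γ j) x y) ⟩
      product-value (α i) (β i) (γ i) (α j) (β j) (γ j) (𝐈 x y) (Q x y) ∎
      where
      open ≡-Reasoning
      w : Fin q → ℤ
      w = row-weight (α j) (β j) (γ j) y
      pair : ∀ t a b → t ℤ.* (t ℤ.* (a ℤ.* b)) ≡ (t ℤ.* a) ℤ.* (t ℤ.* b)
      pair = solve-∀

    halve : ∀ a b → + 2 ℤ.* a ≡ + 2 ℤ.* b → a ≡ b
    halve a b = ℤP.*-cancelˡ-≡ (+ 2) a b

    A-zeroOne : ∀ k → ZeroOne (A k)
    A-zeroOne k x y with cell x y
    ... | l , c rewrite A-value c k with k Fin.≟ l
    ...   | yes _ = inj₂ refl
    ...   | no  _ = inj₁ refl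

    A-partition : ∀ x y → ∑[ k < 3 ] A k x y ≡ + 1
    A-partition x y with cell x y
    ... | l , c = trans (ℤM.sum-cong-≋ {3} (A-value c)) (table l)
      where
      table : ∀ (l : Fin 3) → ∑[ k < 3 ] 𝐈 k l ≡ + 1
      table zero = refl
      table (suc zero) = refl
      table (suc (suc zero)) = refl

    product-commutes : ∀ i j → A i · A j ≋ A j · A i
    product-commutes i j x y = halve ((A i · A j) x y) ((A j · A i) x y)
      (halve (+ 2 ℤ.* (A i · A j) x y) (+ 2 ℤ.* (A j · A i) x y) (trans (double-product i j x y)
        (trans (symmetric (α i) (β i) (γ i) (α j) (β j) (γ j) (+ q) (𝐈 x y) (Q x y)) (sym (double-product j i x y)))))
      where
      symmetric : ∀ a b c a′ b′ c′ q d e →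
        a ℤ.* (a′ ℤ.* q ℤ.+ (b′ ℤ.* + 1 ℤ.+ c′ ℤ.* + 0)) ℤ.+
        (b ℤ.* (a′ ℤ.* + 1 ℤ.+ (b′ ℤ.* d ℤ.+ c′ ℤ.* e)) ℤ.+
         c ℤ.* (a′ ℤ.* + 0 ℤ.+ (b′ ℤ.* e ℤ.+ c′ ℤ.* (+ 1 ℤ.- q ℤ.* d)))) ≡
        a′ ℤ.* (a ℤ.* q ℤ.+ (b ℤ.* + 1 ℤ.+ c ℤ.* + 0)) ℤ.+
        (b′ ℤ.* (a ℤ.* + 1 ℤ.+ (b ℤ.* d ℤ.+ c ℤ.* e)) ℤ.+
         c′ ℤ.* (a ℤ.* + 0 ℤ.+ (b ℤ.* e ℤ.+ c ℤ.* (+ 1 ℤ.- q ℤ.* d))))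
      symmetric = solve-∀

    product-constant : ∀ i j x y x′ y′ {k} → Cell x y k → Cell x′ y′ k → (A i · A j) x y ≡ (A i · A j) x′ y′
    product-constant i j x y x′ y′ c c′ = halve ((A i · A j) x y) ((A i · A j) x′ y′)
      (halve (+ 2 ℤ.* (A i · A j) x y) (+ 2 ℤ.* (A i · A j) x′ y′) (trans (double-product i j x y)
        (trans (cong₂ (product-value (α i) (β i) (γ i) (α j) (β j) (γ j))
          (trans (𝐈-value c) (sym (𝐈-value c′))) (trans (Q-value c) (sym (Q-value c′))))
          (sym (double-product i j x′ y′)))))

    product-nonNegative : ∀ i j x y → + 0 ℤ.≤ (A i · A j) x y
    product-nonNegative i j x y = sum≥0 (λ z → A i x z ℤ.* A j z y) λ z →
      bit (zero-one-* (A-zeroOne i x z) (A-zeroOne j z y))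
      where
      bit : ∀ {a} → a ≡ + 0 ⊎ a ≡ + 1 → + 0 ℤ.≤ a
      bit (inj₁ refl) = ℤ.+≤+ ℕ.z≤n
      bit (inj₂ refl) = ℤ.+≤+ ℕ.z≤n
      sum≥0 : ∀ {n} (f : Fin n → ℤ) → (∀ z → + 0 ℤ.≤ f z) → + 0 ℤ.≤ ∑[ z < n ] f z
      sum≥0 {zero}  f h = ℤP.≤-refl
      sum≥0 {suc n} f h = ℤP.+-mono-≤ (h zero) (sum≥0 (λ z → f (suc z)) (λ z → h (suc z)))

    σ : Fin 3 → Fin 3
    σ zero = zero
    σ (suc zero) = suc (suc zero)
    σ (suc (suc zero)) = suc zero

    A-transposed : ∀ k → A k ᵀ ≋ A (σ k)
    A-transposed k x y = halve (A k y x) (A (σ k) x y) (trans (double k y x)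
      (trans (cong₂ (λ d e → α k ℤ.* + 1 ℤ.+ (β k ℤ.* d ℤ.+ γ k ℤ.* e)) (𝐈-sym y x) (Q-skew x y))
        (trans (table k (𝐈 x y) (Q x y)) (sym (double (σ k) x y)))))
      where
      swap₁ : ∀ d e → + 1 ℤ.* + 1 ℤ.+ (ℤ.- (+ 1) ℤ.* d ℤ.+ + 1 ℤ.* (ℤ.- e)) ≡
              + 1 ℤ.* + 1 ℤ.+ (ℤ.- (+ 1) ℤ.* d ℤ.+ ℤ.- (+ 1) ℤ.* e)
      swap₁ = solve-∀
      swap₂ : ∀ d e → + 1 ℤ.* + 1 ℤ.+ (ℤ.- (+ 1) ℤ.* d ℤ.+ ℤ.- (+ 1) ℤ.* (ℤ.- e)) ≡
              + 1 ℤ.* + 1 ℤ.+ (ℤ.- (+ 1) ℤ.* d ℤ.+ + 1 ℤ.* e)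
      swap₂ = solve-∀
      swap₀ : ∀ d e → + 0 ℤ.* + 1 ℤ.+ (+ 2 ℤ.* d ℤ.+ + 0 ℤ.* (ℤ.- e)) ≡ + 0 ℤ.* + 1 ℤ.+ (+ 2 ℤ.* d ℤ.+ + 0 ℤ.* e)
      swap₀ = solve-∀
      table : ∀ k d e → α k ℤ.* + 1 ℤ.+ (β k ℤ.* d ℤ.+ γ k ℤ.* (ℤ.- e)) ≡
              α (σ k) ℤ.* + 1 ℤ.+ (β (σ k) ℤ.* d ℤ.+ γ (σ k) ℤ.* e)
      table zero = swap₀
      table (suc zero) = swap₁
      table (suc (suc zero)) = swap₂

  module _ (q>1 : 1 ℕ.< q) where

    abstract
      representative : ∀ k → ∃₂ λ x y → Cell x y k
      representative = go q>1 cell Q-skew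
        where
        go : 1 ℕ.< q → (∀ x y → ∃ (Cell x y)) → (∀ x y → Q y x ≡ ℤ.- Q x y) → ∀ k → ∃₂ λ x y → Cell x y k
        go 1<q c s k = pick k
          where
          a b : Fin q
          a = Fin.fromℕ< {0} (ℕP.<-trans (ℕ.s≤s ℕ.z≤n) 1<q)
          b = Fin.fromℕ< {1} 1<q
          a≢b : a ≢ b
          a≢b e with trans (sym (Fin.toℕ-fromℕ< (ℕP.<-trans (ℕ.s≤s ℕ.z≤n) 1<q))) (trans (cong Fin.toℕ e) (Fin.toℕ-fromℕ< 1<q))
          ... | ()
          𝐈-one : ∀ (x y : Fin q) → 𝐈 x y ≡ + 1 → x ≡ y
          𝐈-one x y e with x Fin.≟ y
          ... | yes p = p
          𝐈-diag : ∀ (x : Fin q) → 𝐈 x x ≡ + 1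
          𝐈-diag x with x Fin.≟ x
          ... | yes _ = refl
          ... | no ¬p = contradiction refl ¬p
          diagonal-cell : ∃ (Cell a a) → Cell a a zero
          diagonal-cell (zero , c) = c
          diagonal-cell (suc _ , c) with trans (sym (𝐈-diag a)) (𝐈-value c)
          ... | ()
          sides : ∃ (Cell a b) → ∃ (Cell b a) → (∃₂ λ x y → Cell x y (suc zero)) × (∃₂ λ x y → Cell x y (suc (suc zero)))
          sides (zero , c) _ = contradiction (𝐈-one a b (𝐈-value c)) a≢b
          sides _ (zero , c) = contradiction (sym (𝐈-one b a (𝐈-value c))) a≢b
          sides (suc zero , c) (suc (suc zero) , c′) = (a , b , c) , (b , a , c′)
          sides (suc (suc zero) , c) (suc zero , c′) = (b , a , c′) , (a , b , c)
          sides (suc zero , c) (suc zero , c′) with trans (sym (Q-value c′)) (trans (s a b) (cong ℤ.-_ (Q-value c)))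
          ... | ()
          sides (suc (suc zero) , c) (suc (suc zero) , c′) with trans (sym (Q-value c′)) (trans (s a b) (cong ℤ.-_ (Q-value c)))
          ... | ()
          pick : ∀ k → ∃₂ λ x y → Cell x y k
          pick zero             = a , a , diagonal-cell (c a a)
          pick (suc zero)       = proj₁ (sides (c a b) (c b a))
          pick (suc (suc zero)) = proj₂ (sides (c a b) (c b a))

    intersection : Fin 3 → Fin 3 → Fin 3 → ℕ
    intersection i j k = let x , y , _ = representative k in ℤ.∣ (A i · A j) x y ∣

    abstract
      A-nonzero : ∀ k → ∃₂ λ x y → A k x y ≡ + 1
      A-nonzero k = let x , y , c = representative k in x , y , trans (A-value c k) (table k)
        where
        table : ∀ (k : Fin 3) → 𝐈 k k ≡ + 1
        table zero = refl
        table (suc zero) = refl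
        table (suc (suc zero)) = refl

      A-product : ∀ i j → A i · A j ≋ combination (λ k → + intersection i j k) A
      A-product i j x y = go (proj₁ (cell x y)) (proj₂ (cell x y))
        where
        open ≡-Reasoning
        go : ∀ k → Cell x y k → (A i · A j) x y ≡ combination (λ k → + intersection i j k) A x y
        go k c = begin
          (A i · A j) x y
            ≡⟨ product-constant i j x y x′ y′ c (proj₂ (proj₂ (representative k))) ⟩
          (A i · A j) x′ y′
            ≡⟨ ℤP.0≤i⇒+∣i∣≡i (product-nonNegative i j x′ y′) ⟨
          + intersection i j k
            ≡⟨ ℤM.sum-δ k (λ l → + intersection i j l) ⟨
          ∑[ l < 3 ] (𝐈 k l ℤ.* + intersection i j l)
            ≡⟨ ℤM.sum-cong-≋ {3} (λ l → trans (ℤP.*-comm (𝐈 k l) (+ intersection i j l))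
                 (cong (ℤ._*_ (+ intersection i j l)) (trans (𝐈-sym k l) (sym (A-value c l))))) ⟩
          combination (λ l → + intersection i j l) A x y ∎
          where
          x′ y′ : Fin q
          x′ = proj₁ (representative k)
          y′ = proj₁ (proj₂ (representative k))

    scheme : CommutativeAssociationScheme q 3
    scheme = record
      { adj         = A
      ; zeroOne     = A-zeroOne
      ; nonzero     = A-nonzero
      ; identity    = zero , λ _ _ → refl
      ; partition   = A-partition
      ; transposed  = λ k → σ k , A-transposed k
      ; p           = intersection
      ; product     = A-product
      ; commutative = product-commutes
      }

-- The scheme with adjacency matrices I, A₁, A₂; q > 1 makes A₁ and A₂ nonzero.
𝔛 : ∀ {q} {Q A₁ A₂ : Matrix q q} → 1 ℕ.< q → IsSkewSymmetricCore Q → Splitting Q A₁ A₂ →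
    CommutativeAssociationScheme q 3
𝔛 q>1 core split = 𝔛-construction.scheme core split q>1

⟪_⟫ : ∀ {m n} → Matrix m n → ℂM.Matrix m n
⟪ A ⟫ x y = fromℤ (A x y)

infix 4 _∈BoseMesner_
_∈BoseMesner_ : ∀ {n r} → ℂM.Matrix n n → CommutativeAssociationScheme n r → Set
_∈BoseMesner_ {r = r} H S = ∃ λ (c : Fin r → ℂ) → H ℂM.≋ ℂM.combination c (λ k → ⟪ adj S k ⟫)

_† : ∀ {m n} → ℂM.Matrix m n → ℂM.Matrix n m
(H †) x y = conj (H y x)

-- 1 / √(q+1) is rendered as √ (1 / (q+1)).
IsQuaternaryUnitHadamard : ℕ → ∀ {n} → ℂM.Matrix n n → Set
IsQuaternaryUnitHadamard q {n} H =
  (∀ x y → ∃₂ λ ε δ → (ε ≡ + 1 ⊎ ε ≡ -1ℤ) × (δ ≡ + 1 ⊎ δ ≡ -1ℤ) ×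
    H x y ≈ᶜ fromℤ ε *ᶜ fromℝ (√ 1 / suc q) +ᶜ fromℤ δ *ᶜ (𝕚 *ᶜ fromℝ (√ q / suc q))) ×
  H ℂM.· (H †) ℂM.≋ fromℤ (+ n) ℂM.• ℂM.𝐈

quaternaryUnitMatrix : ∀ {q} → Matrix q q → ∀ m → ℂM.Matrix (q ℕ.^ m) (q ℕ.^ m)
quaternaryUnitMatrix {q} Q m =
  fromℝ (√ 1 / suc q) ℂM.• ⟪ 𝒥 Q m ⟫ ℂM.⊕ (𝕚 *ᶜ fromℝ (√ q / suc q)) ℂM.• ⟪ 𝒜 Q m ⟫

{-# OPTIONS --safe #-}

-- With J = 𝒥 m and A = 𝒜 m, the recursion preserves A Jᵀ = J Aᵀ and J Jᵀ + q A Aᵀ = (q + 1) qᵐ I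
-- (in the second, the Kronecker terms J ⊗ A Aᵀ cancel because Q Qᵀ = q I − J).  Expanding H H* for
-- H = a J + i b A gives a² J Jᵀ + b² A Aᵀ + i a b (A Jᵀ − J Aᵀ), which these identities evaluate.
-- Membership in the Bose–Mesner algebra follows from J = A₀ + A₁ + A₂, I = A₀ and Q = A₁ − A₂ by
-- bilinearity of ⊗.
module Submission where

open import Defs
open import Data.Nat using (ℕ; _<_; _≤_; _^_)
open import Data.Product using (_×_)
open ℤM using (Matrix)
open import Algebra.Bundles using (CommutativeRing)
open import Data.Fin as Fin using (Fin; zero; suc; quotient; remainder)
open import Data.Integer as ℤ using (ℤ; +_; -1ℤ)
import Data.Integer.Properties as ℤP
open import Data.Integer.Tactic.RingSolver using (solve-∀)
open import Data.Nat as ℕ using (zero; suc)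
import Data.Nat.Properties as ℕP
open import Data.Product using (∃; _,_; proj₁; proj₂)
open import Data.Rational as ℚ using (ℚ; 0ℚ; 1ℚ)
import Data.Rational.Properties as ℚP
open import Data.Rational.Solver using (module +-*-Solver)
import Data.Rational.Unnormalised as ℚᵘ
import Data.Rational.Unnormalised.Properties as ℚᵘP
open import Data.Sum using (_⊎_; inj₁; inj₂)
open import Relation.Binary.PropositionalEquality using (_≡_; refl; sym; trans; cong; cong₂; module ≡-Reasoning)
import Relation.Binary.Reasoning.Setoid as SetoidReasoning
open import Relation.Nullary using (yes; no)
open ℤM using (_≋_; 𝐈; 𝐉; _⊕_; _·_; _⊗_; _ᵀ; _•_; combination)
open CommutativeAssociationScheme using (adj)
open ℝ
open ℂ

-- Linear spans of matrices over a commutative ring.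

module Span {c ℓ} (R : CommutativeRing c ℓ) where

  open CommutativeRing R hiding (zero; refl; sym; trans)
  private
    module ≈ = CommutativeRing R using (refl; sym; trans)
    module M = Matrices R
  open M using (sum-syntax)
  open SetoidReasoning setoid

  infix 4 _∈Span_
  -- The ring is left general to serve both ℤ, where the recursion lives, and ℂ, where for the
  -- family `⟪ adj S k ⟫` this unfolds to `_∈BoseMesner_`.
  _∈Span_ : ∀ {r m n} → M.Matrix m n → (Fin r → M.Matrix m n) → Set _
  B ∈Span A = ∃ λ a → B M.≋ M.combination a A

  ·-distribˡ-⊕ : ∀ {l m n} (A : M.Matrix l m) (B C : M.Matrix m n) →
                 A M.· (B M.⊕ C) M.≋ A M.· B M.⊕ A M.· C
  ·-distribˡ-⊕ A B C x y = ≈.trans (M.sum-cong-≋ λ z → distribˡ (A x z) (B z y) (C z y))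
    (M.∑-distrib-+ (λ z → A x z * B z y) (λ z → A x z * C z y))

  ·-distribʳ-⊕ : ∀ {l m n} (A B : M.Matrix l m) (C : M.Matrix m n) →
                 (A M.⊕ B) M.· C M.≋ A M.· C M.⊕ B M.· C
  ·-distribʳ-⊕ A B C x y = ≈.trans (M.sum-cong-≋ λ z → distribʳ (C z y) (A x z) (B x z))
    (M.∑-distrib-+ (λ z → A x z * C z y) (λ z → B x z * C z y))

  ∈Span-⊕ : ∀ {r m n} {B C : M.Matrix m n} {A : Fin r → M.Matrix m n} →
            B ∈Span A → C ∈Span A → B M.⊕ C ∈Span A
  ∈Span-⊕ {r} {B = B} {C} {A} (b , B≋) (c , C≋) = (λ k → b k + c k) , λ x y → begin
    B x y + C x y
      ≈⟨ +-cong (B≋ x y) (C≋ x y) ⟩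
    ∑[ k < r ] (b k * A k x y) + ∑[ k < r ] (c k * A k x y)
      ≈⟨ M.∑-distrib-+ (λ k → b k * A k x y) (λ k → c k * A k x y) ⟨
    ∑[ k < r ] (b k * A k x y + c k * A k x y)
      ≈⟨ M.sum-cong-≋ (λ k → distribʳ (A k x y) (b k) (c k)) ⟨
    ∑[ k < r ] ((b k + c k) * A k x y) ∎

  ∈Span-• : ∀ {r m n} {B : M.Matrix m n} {A : Fin r → M.Matrix m n} a →
            B ∈Span A → a M.• B ∈Span A
  ∈Span-• {r} {B = B} {A} a (b , B≋) = (λ k → a * b k) , λ x y → begin
    a * B x y                         ≈⟨ *-congˡ (B≋ x y) ⟩
    a * ∑[ k < r ] (b k * A k x y)    ≈⟨ M.*-distribˡ-sum a (λ k → b k * A k x y) ⟩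
    ∑[ k < r ] (a * (b k * A k x y))  ≈⟨ M.sum-cong-≋ (λ k → *-assoc a (b k) (A k x y)) ⟨
    ∑[ k < r ] ((a * b k) * A k x y)  ∎

  -- Bilinearity: the coefficient at a pair of indices is the product of the two coefficients. Pairs
  -- are coded as in `_⊠_`, so the resulting family is definitionally that of a tensor product of
  -- schemes.
  ∈Span-⊗ : ∀ {r r′ m n m′ n′} {B : M.Matrix m n} {C : M.Matrix m′ n′}
            {A : Fin r → M.Matrix m n} {A′ : Fin r′ → M.Matrix m′ n′} →
            B ∈Span A → C ∈Span A′ →
            B M.⊗ C ∈Span (λ k → A (quotient {r} r′ k) M.⊗ A′ (remainder {r} r′ k))
  ∈Span-⊗ {r} {r′} {m} {n} {m′} {n′} {B} {C} {A} {A′} (b , B≋) (c , C≋) =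
    (λ k → b (quotient {r} r′ k) * c (remainder {r} r′ k)) ,
    λ x y → entry (quotient {m} m′ x) (quotient {n} n′ y) (remainder {m} m′ x) (remainder {n} n′ y)
    where
    entry : ∀ x₁ y₁ x₂ y₂ → B x₁ y₁ * C x₂ y₂ ≈
      ∑[ k < r ℕ.* r′ ] ((b (quotient {r} r′ k) * c (remainder {r} r′ k)) *
                         (A (quotient {r} r′ k) x₁ y₁ * A′ (remainder {r} r′ k) x₂ y₂))
    entry x₁ y₁ x₂ y₂ = begin
      B x₁ y₁ * C x₂ y₂
        ≈⟨ *-cong (B≋ x₁ y₁) (C≋ x₂ y₂) ⟩
      ∑[ k < r ] (b k * A k x₁ y₁) * ∑[ k < r′ ] (c k * A′ k x₂ y₂)
        ≈⟨ M.sum-remQuot r r′ (λ k → b k * A k x₁ y₁) (λ k → c k * A′ k x₂ y₂) ⟨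
      ∑[ k < r ℕ.* r′ ] ((b (quotient {r} r′ k) * A (quotient {r} r′ k) x₁ y₁) *
                         (c (remainder {r} r′ k) * A′ (remainder {r} r′ k) x₂ y₂))
        ≈⟨ M.sum-cong-≋ {r ℕ.* r′} (λ k → M.interchange (b (quotient {r} r′ k)) (A (quotient {r} r′ k) x₁ y₁)
             (c (remainder {r} r′ k)) (A′ (remainder {r} r′ k) x₂ y₂)) ⟩
      ∑[ k < r ℕ.* r′ ] ((b (quotient {r} r′ k) * c (remainder {r} r′ k)) *
                         (A (quotient {r} r′ k) x₁ y₁ * A′ (remainder {r} r′ k) x₂ y₂)) ∎

module ℤS = Span ℤP.+-*-commutativeRing
module ℂS = Span ℂ-commutativeRing
open ℤS using (_∈Span_)

-- The recursive matrices over ℤ: membership in the span and entries.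

Sign : ℤ → Set
Sign a = a ≡ + 1 ⊎ a ≡ -1ℤ

module _ {q} {Q A₁ A₂ : Matrix q q} (core : IsSkewSymmetricCore Q) (split : Splitting Q A₁ A₂) where

  open 𝔛-construction core split
  open ℤM using (sum-syntax)
  open Cell
  open ≡-Reasoning

  -- At a position in relation k, `A k` is one and the other two adjacency matrices vanish, so only
  -- the k-th term of the sum survives.
  combination-value : ∀ (a : Fin 3 → ℤ) {x y k} → Cell x y k → combination a A x y ≡ a k
  combination-value a {x} {y} {k} c = begin
    ∑[ l < 3 ] (a l ℤ.* A l x y)
      ≡⟨ ℤM.sum-cong-≋ {3} (λ l → trans (ℤP.*-comm (a l) (A l x y)) (cong (ℤ._* a l) (trans (A-value c l) (𝐈-sym l k)))) ⟩
    ∑[ l < 3 ] (𝐈 k l ℤ.* a l)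
      ≡⟨ ℤM.sum-δ k a ⟩
    a k ∎

  -- Every position lies in some relation, so the values on the relations serve as coefficients.
  -- This treats J, I and Q uniformly, with coefficients 1, `δ` and `ε`.
  constant-∈Span : ∀ (a : Fin 3 → ℤ) {B : Matrix q q} →
                   (∀ {x y k} → Cell x y k → B x y ≡ a k) → B ∈Span A
  constant-∈Span a B-value = a , λ x y → let k , c = cell x y in
    trans (B-value c) (sym (combination-value a c))

  module _ (q>1 : 1 < q) where

    𝔛^ : ∀ m → CommutativeAssociationScheme (q ^ m) (3 ^ m)
    𝔛^ m = 𝔛 q>1 core split ^⊠ m

    tensor-∈Span : ∀ m (B : Matrix q q) (C : Matrix (q ^ m) (q ^ m)) →
                   B ∈Span A → C ∈Span adj (𝔛^ m) → B ⊗ C ∈Span adj (𝔛^ (suc m))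
    tensor-∈Span m B C = ℤS.∈Span-⊗ {B = B} {C} {A} {adj (𝔛^ m)}

    mutual
      𝒥-∈Span : ∀ m → 𝒥 Q m ∈Span adj (𝔛^ m)
      -- The zeroth tensor power is the one-point scheme, whose only adjacency matrix is the 1 × 1
      -- all-ones matrix.
      𝒥-∈Span zero    = (λ _ → + 1) , λ _ _ → refl
      𝒥-∈Span (suc m) = tensor-∈Span m 𝐉 (𝒜 Q m) (constant-∈Span (λ _ → + 1) λ _ → refl) (𝒜-∈Span m)

      𝒜-∈Span : ∀ m → 𝒜 Q m ∈Span adj (𝔛^ m)
      𝒜-∈Span zero    = (λ _ → + 1) , λ _ _ → refl
      𝒜-∈Span (suc m) = ℤS.∈Span-⊕ {B = 𝐈 {q} ⊗ 𝒥 Q m} {Q ⊗ 𝒜 Q m} {adj (𝔛^ (suc m))}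
        (tensor-∈Span m 𝐈 (𝒥 Q m) (constant-∈Span δ 𝐈-value) (𝒥-∈Span m))
        (tensor-∈Span m Q (𝒜 Q m) (constant-∈Span ε Q-value) (𝒜-∈Span m))

  mutual
    𝒥-sign : ∀ m x y → Sign (𝒥 Q m x y)
    𝒥-sign zero    x y = inj₁ refl
    𝒥-sign (suc m) x y with 𝒜 Q m (remainder {q} (q ^ m) x) (remainder {q} (q ^ m) y)
                          | 𝒜-sign m (remainder {q} (q ^ m) x) (remainder {q} (q ^ m) y)
    ... | _ | inj₁ refl = inj₁ refl
    ... | _ | inj₂ refl = inj₂ refl

    -- I and Q have disjoint supports that together cover all positions, so no two nonzero terms are
    -- ever added: on the diagonal blocks an entry of `𝒥` is copied, elsewhere an entry of `𝒜` up to
    -- sign.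
    𝒜-sign : ∀ m x y → Sign (𝒜 Q m x y)
    𝒜-sign zero    x y = inj₁ refl
    𝒜-sign (suc m) x y = sign (proj₂ (cell (quotient {q} (q ^ m) x) (quotient {q} (q ^ m) y)))
      (𝒥-sign m (remainder {q} (q ^ m) x) (remainder {q} (q ^ m) y))
      (𝒜-sign m (remainder {q} (q ^ m) x) (remainder {q} (q ^ m) y))
      where
      table : ∀ (k : Fin 3) {s t} → Sign s → Sign t → Sign (δ k ℤ.* s ℤ.+ ε k ℤ.* t)
      table zero             (inj₁ refl) (inj₁ refl) = inj₁ refl
      table zero             (inj₁ refl) (inj₂ refl) = inj₁ refl
      table zero             (inj₂ refl) (inj₁ refl) = inj₂ refl
      table zero             (inj₂ refl) (inj₂ refl) = inj₂ refl
      table (suc zero)       (inj₁ refl) (inj₁ refl) = inj₁ refl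
      table (suc zero)       (inj₁ refl) (inj₂ refl) = inj₂ refl
      table (suc zero)       (inj₂ refl) (inj₁ refl) = inj₁ refl
      table (suc zero)       (inj₂ refl) (inj₂ refl) = inj₂ refl
      table (suc (suc zero)) (inj₁ refl) (inj₁ refl) = inj₂ refl
      table (suc (suc zero)) (inj₁ refl) (inj₂ refl) = inj₁ refl
      table (suc (suc zero)) (inj₂ refl) (inj₁ refl) = inj₂ refl
      table (suc (suc zero)) (inj₂ refl) (inj₂ refl) = inj₁ refl
      sign : ∀ {x y k s t} → Cell x y k → Sign s → Sign t → Sign (𝐈 x y ℤ.* s ℤ.+ Q x y ℤ.* t)
      sign {k = k} c p r rewrite 𝐈-value c | Q-value c = table k p r

  -- Block products and Gram identities over ℤ.

  I·ᵀ : ∀ (B : Matrix q q) x y → (𝐈 · B ᵀ) x y ≡ B y x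
  I·ᵀ B x y = ℤM.sum-δ x (B y)

  ·Iᵀ : ∀ (B : Matrix q q) x y → (B · 𝐈 ᵀ) x y ≡ B x y
  ·Iᵀ B x y = trans (ℤM.sum-cong-≋ {q} λ z → ℤP.*-comm (B x z) (𝐈 y z)) (ℤM.sum-δ y (B x))

  J·Jᵀ : ∀ (x y : Fin q) → (𝐉 {q} {q} · 𝐉 ᵀ) x y ≡ + q
  J·Jᵀ x y = sum-1 q

  -- The rows of the core sum to zero. This and `Q·Jᵀ` remove the Q-blocks from the mixed products
  -- of `𝒥` and `𝒜`.
  J·Qᵀ : ∀ (x y : Fin q) → (𝐉 {q} {q} · Q ᵀ) x y ≡ + 0
  J·Qᵀ x y = trans (ℤM.sum-cong-≋ {q} λ z → ℤP.*-identityˡ (Q y z)) (Q-row-sum y)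

  Q·Jᵀ : ∀ (x y : Fin q) → (Q · 𝐉 {q} {q} ᵀ) x y ≡ + 0
  Q·Jᵀ x y = trans (ℤM.sum-cong-≋ {q} λ z → ℤP.*-identityʳ (Q x z)) (Q-row-sum x)

  -- Subscript 1 marks the position of a block and subscript 2 the position inside it. The
  -- mixed-product property of ⊗ then expresses each product at level m + 1 through products at
  -- level m.
  module Step (m : ℕ) (x y : Fin (q ^ suc m)) where

    J A′ : Matrix (q ^ m) (q ^ m)
    J  = 𝒥 Q m
    A′ = 𝒜 Q m

    x₁ y₁ : Fin q
    x₁ = quotient {q} (q ^ m) x
    y₁ = quotient {q} (q ^ m) y

    x₂ y₂ : Fin (q ^ m)
    x₂ = remainder {q} (q ^ m) x
    y₂ = remainder {q} (q ^ m) y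

    𝒥𝒥ᵀ : (𝒥 Q (suc m) · 𝒥 Q (suc m) ᵀ) x y ≡ + q ℤ.* (A′ · A′ ᵀ) x₂ y₂
    𝒥𝒥ᵀ = trans (ℤM.⊗-· (𝐉 {q} {q}) A′ (𝐉 {q} {q} ᵀ) (A′ ᵀ) x y)
      (cong (ℤ._* (A′ · A′ ᵀ) x₂ y₂) (J·Jᵀ x₁ y₁))

    -- Against the all-ones block, I gives 1 at every position and Qᵀ gives 0, so a single inner
    -- product survives, with the roles of `𝒥` and `𝒜` exchanged.
    𝒥𝒜ᵀ : (𝒥 Q (suc m) · 𝒜 Q (suc m) ᵀ) x y ≡ (A′ · J ᵀ) x₂ y₂
    𝒥𝒜ᵀ = begin
      (𝒥 Q (suc m) · 𝒜 Q (suc m) ᵀ) x y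
        ≡⟨ ℤS.·-distribˡ-⊕ (𝐉 {q} {q} ⊗ A′) (𝐈 {q} ᵀ ⊗ J ᵀ) (Q ᵀ ⊗ A′ ᵀ) x y ⟩
      ((𝐉 {q} {q} ⊗ A′) · (𝐈 {q} ᵀ ⊗ J ᵀ)) x y ℤ.+ ((𝐉 {q} {q} ⊗ A′) · (Q ᵀ ⊗ A′ ᵀ)) x y
        ≡⟨ cong₂ ℤ._+_ (ℤM.⊗-· (𝐉 {q} {q}) A′ (𝐈 {q} ᵀ) (J ᵀ) x y) (ℤM.⊗-· (𝐉 {q} {q}) A′ (Q ᵀ) (A′ ᵀ) x y) ⟩
      (𝐉 {q} {q} · 𝐈 ᵀ) x₁ y₁ ℤ.* (A′ · J ᵀ) x₂ y₂ ℤ.+ (𝐉 {q} {q} · Q ᵀ) x₁ y₁ ℤ.* (A′ · A′ ᵀ) x₂ y₂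
        ≡⟨ cong₂ (λ s t → s ℤ.* (A′ · J ᵀ) x₂ y₂ ℤ.+ t ℤ.* (A′ · A′ ᵀ) x₂ y₂) (·Iᵀ 𝐉 x₁ y₁) (J·Qᵀ x₁ y₁) ⟩
      + 1 ℤ.* (A′ · J ᵀ) x₂ y₂ ℤ.+ + 0 ℤ.* (A′ · A′ ᵀ) x₂ y₂
        ≡⟨ simplify ((A′ · J ᵀ) x₂ y₂) ((A′ · A′ ᵀ) x₂ y₂) ⟩
      (A′ · J ᵀ) x₂ y₂ ∎
      where
      simplify : ∀ s t → + 1 ℤ.* s ℤ.+ + 0 ℤ.* t ≡ s
      simplify = solve-∀

    𝒜𝒥ᵀ : (𝒜 Q (suc m) · 𝒥 Q (suc m) ᵀ) x y ≡ (J · A′ ᵀ) x₂ y₂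
    𝒜𝒥ᵀ = begin
      (𝒜 Q (suc m) · 𝒥 Q (suc m) ᵀ) x y
        ≡⟨ ℤS.·-distribʳ-⊕ (𝐈 {q} ⊗ J) (Q ⊗ A′) (𝐉 {q} {q} ᵀ ⊗ A′ ᵀ) x y ⟩
      ((𝐈 {q} ⊗ J) · (𝐉 {q} {q} ᵀ ⊗ A′ ᵀ)) x y ℤ.+ ((Q ⊗ A′) · (𝐉 {q} {q} ᵀ ⊗ A′ ᵀ)) x y
        ≡⟨ cong₂ ℤ._+_ (ℤM.⊗-· (𝐈 {q}) J (𝐉 {q} {q} ᵀ) (A′ ᵀ) x y) (ℤM.⊗-· Q A′ (𝐉 {q} {q} ᵀ) (A′ ᵀ) x y) ⟩
      (𝐈 {q} · 𝐉 ᵀ) x₁ y₁ ℤ.* (J · A′ ᵀ) x₂ y₂ ℤ.+ (Q · 𝐉 {q} {q} ᵀ) x₁ y₁ ℤ.* (A′ · A′ ᵀ) x₂ y₂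
        ≡⟨ cong₂ (λ s t → s ℤ.* (J · A′ ᵀ) x₂ y₂ ℤ.+ t ℤ.* (A′ · A′ ᵀ) x₂ y₂) (I·ᵀ 𝐉 x₁ y₁) (Q·Jᵀ x₁ y₁) ⟩
      + 1 ℤ.* (J · A′ ᵀ) x₂ y₂ ℤ.+ + 0 ℤ.* (A′ · A′ ᵀ) x₂ y₂
        ≡⟨ simplify ((J · A′ ᵀ) x₂ y₂) ((A′ · A′ ᵀ) x₂ y₂) ⟩
      (J · A′ ᵀ) x₂ y₂ ∎
      where
      simplify : ∀ s t → + 1 ℤ.* s ℤ.+ + 0 ℤ.* t ≡ s
      simplify = solve-∀

    -- The four terms come from the outer products I Iᵀ, I Qᵀ, Q Iᵀ and Q Qᵀ. Skew symmetry rewrites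
    -- I Qᵀ as -Q, and the core equation gives the coefficient of the last term.
    𝒜𝒜ᵀ : (𝒜 Q (suc m) · 𝒜 Q (suc m) ᵀ) x y ≡
      (𝐈 x₁ y₁ ℤ.* (J · J ᵀ) x₂ y₂ ℤ.+ ℤ.- Q x₁ y₁ ℤ.* (J · A′ ᵀ) x₂ y₂) ℤ.+
      (Q x₁ y₁ ℤ.* (A′ · J ᵀ) x₂ y₂ ℤ.+ (+ q ℤ.* 𝐈 x₁ y₁ ℤ.- + 1) ℤ.* (A′ · A′ ᵀ) x₂ y₂)
    𝒜𝒜ᵀ = begin
      (𝒜 Q (suc m) · 𝒜 Q (suc m) ᵀ) x y
        ≡⟨ ℤS.·-distribʳ-⊕ (𝐈 {q} ⊗ J) (Q ⊗ A′) (𝒜 Q (suc m) ᵀ) x y ⟩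
      ((𝐈 {q} ⊗ J) · 𝒜 Q (suc m) ᵀ) x y ℤ.+ ((Q ⊗ A′) · 𝒜 Q (suc m) ᵀ) x y
        ≡⟨ cong₂ ℤ._+_ (half 𝐈 J) (half Q A′) ⟩
      ((𝐈 · 𝐈 ᵀ) x₁ y₁ ℤ.* (J · J ᵀ) x₂ y₂ ℤ.+ (𝐈 · Q ᵀ) x₁ y₁ ℤ.* (J · A′ ᵀ) x₂ y₂) ℤ.+
      ((Q · 𝐈 ᵀ) x₁ y₁ ℤ.* (A′ · J ᵀ) x₂ y₂ ℤ.+ (Q · Q ᵀ) x₁ y₁ ℤ.* (A′ · A′ ᵀ) x₂ y₂)
        ≡⟨ cong₂ ℤ._+_
             (cong₂ (λ s t → s ℤ.* (J · J ᵀ) x₂ y₂ ℤ.+ t ℤ.* (J · A′ ᵀ) x₂ y₂)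
               (·Iᵀ 𝐈 x₁ y₁) (trans (I·ᵀ Q x₁ y₁) (Q-skew x₁ y₁)))
             (cong₂ (λ s t → s ℤ.* (A′ · J ᵀ) x₂ y₂ ℤ.+ t ℤ.* (A′ · A′ ᵀ) x₂ y₂)
               (·Iᵀ Q x₁ y₁) (QQᵀ x₁ y₁)) ⟩
      (𝐈 x₁ y₁ ℤ.* (J · J ᵀ) x₂ y₂ ℤ.+ ℤ.- Q x₁ y₁ ℤ.* (J · A′ ᵀ) x₂ y₂) ℤ.+
      (Q x₁ y₁ ℤ.* (A′ · J ᵀ) x₂ y₂ ℤ.+ (+ q ℤ.* 𝐈 x₁ y₁ ℤ.- + 1) ℤ.* (A′ · A′ ᵀ) x₂ y₂) ∎
      where
      half : ∀ (B : Matrix q q) (C : Matrix (q ^ m) (q ^ m)) → ((B ⊗ C) · 𝒜 Q (suc m) ᵀ) x y ≡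
        (B · 𝐈 ᵀ) x₁ y₁ ℤ.* (C · J ᵀ) x₂ y₂ ℤ.+ (B · Q ᵀ) x₁ y₁ ℤ.* (C · A′ ᵀ) x₂ y₂
      half B C = trans (ℤS.·-distribˡ-⊕ (B ⊗ C) (𝐈 {q} ᵀ ⊗ J ᵀ) (Q ᵀ ⊗ A′ ᵀ) x y)
        (cong₂ ℤ._+_ (ℤM.⊗-· B C (𝐈 {q} ᵀ) (J ᵀ) x y) (ℤM.⊗-· B C (Q ᵀ) (A′ ᵀ) x y))

  -- One level of the recursion carries each side to the opposite side at level m, so the induction
  -- hypothesis is applied in reverse.
  𝒜𝒥ᵀ≋𝒥𝒜ᵀ : ∀ m → 𝒜 Q m · 𝒥 Q m ᵀ ≋ 𝒥 Q m · 𝒜 Q m ᵀ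
  𝒜𝒥ᵀ≋𝒥𝒜ᵀ zero    x y = refl
  𝒜𝒥ᵀ≋𝒥𝒜ᵀ (suc m) x y = trans 𝒜𝒥ᵀ (trans (sym (𝒜𝒥ᵀ≋𝒥𝒜ᵀ m x₂ y₂)) (sym 𝒥𝒜ᵀ))
    where open Step m x y

  -- The weights 1 and q are the squared coefficients 1/(q+1) and q/(q+1) cleared of their
  -- denominator.
  𝒥𝒥ᵀ+q𝒜𝒜ᵀ : ∀ m → 𝒥 Q m · 𝒥 Q m ᵀ ⊕ + q • (𝒜 Q m · 𝒜 Q m ᵀ) ≋ + suc q • + (q ^ m) • 𝐈
  𝒥𝒥ᵀ+q𝒜𝒜ᵀ zero zero zero = base (+ q)
    where
    base : ∀ q → + 1 ℤ.+ q ℤ.* + 1 ≡ (+ 1 ℤ.+ q) ℤ.* (+ 1 ℤ.* + 1)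
    base = solve-∀
  𝒥𝒥ᵀ+q𝒜𝒜ᵀ (suc m) x y = begin
    (𝒥 Q (suc m) · 𝒥 Q (suc m) ᵀ) x y ℤ.+ + q ℤ.* (𝒜 Q (suc m) · 𝒜 Q (suc m) ᵀ) x y
      ≡⟨ cong₂ (λ s t → s ℤ.+ + q ℤ.* t) 𝒥𝒥ᵀ (trans 𝒜𝒜ᵀ
           (cong (λ u → (𝐈 x₁ y₁ ℤ.* jj ℤ.+ ℤ.- Q x₁ y₁ ℤ.* ja) ℤ.+ (Q x₁ y₁ ℤ.* u ℤ.+ (+ q ℤ.* 𝐈 x₁ y₁ ℤ.- + 1) ℤ.* aa))
             (𝒜𝒥ᵀ≋𝒥𝒜ᵀ m x₂ y₂))) ⟩
    + q ℤ.* aa ℤ.+ + q ℤ.* ((𝐈 x₁ y₁ ℤ.* jj ℤ.+ ℤ.- Q x₁ y₁ ℤ.* ja) ℤ.+ (Q x₁ y₁ ℤ.* ja ℤ.+ (+ q ℤ.* 𝐈 x₁ y₁ ℤ.- + 1) ℤ.* aa))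
      -- With the symmetry at level m already applied, the terms in -Q and Q share the factor `ja`
      -- and cancel. The -1 from Q Qᵀ, multiplied by q, cancels the leading `q aa`.
      ≡⟨ cancel (+ q) (𝐈 x₁ y₁) (Q x₁ y₁) jj ja aa ⟩
    + q ℤ.* 𝐈 x₁ y₁ ℤ.* (jj ℤ.+ + q ℤ.* aa)
      ≡⟨ cong (+ q ℤ.* 𝐈 x₁ y₁ ℤ.*_) (𝒥𝒥ᵀ+q𝒜𝒜ᵀ m x₂ y₂) ⟩
    + q ℤ.* 𝐈 x₁ y₁ ℤ.* (+ suc q ℤ.* (+ (q ^ m) ℤ.* 𝐈 x₂ y₂))
      ≡⟨ regroup (+ q) (𝐈 x₁ y₁) (+ suc q) (+ (q ^ m)) (𝐈 x₂ y₂) ⟩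
    + suc q ℤ.* (+ q ℤ.* + (q ^ m) ℤ.* (𝐈 x₁ y₁ ℤ.* 𝐈 x₂ y₂))
      ≡⟨ cong₂ (λ s t → + suc q ℤ.* (s ℤ.* t)) (sym (ℤP.pos-* q (q ^ m))) (ℤM.𝐈⊗𝐈 {q} {q ^ m} x y) ⟩
    + suc q ℤ.* (+ (q ^ suc m) ℤ.* 𝐈 x y) ∎
    where
    open Step m x y
    jj ja aa : ℤ
    jj = (J · J ᵀ) x₂ y₂
    ja = (J · A′ ᵀ) x₂ y₂
    aa = (A′ · A′ ᵀ) x₂ y₂
    cancel : ∀ q d e jj ja aa →
      q ℤ.* aa ℤ.+ q ℤ.* ((d ℤ.* jj ℤ.+ ℤ.- e ℤ.* ja) ℤ.+ (e ℤ.* ja ℤ.+ (q ℤ.* d ℤ.- + 1) ℤ.* aa)) ≡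
      q ℤ.* d ℤ.* (jj ℤ.+ q ℤ.* aa)
    cancel = solve-∀
    regroup : ∀ q d s n e → q ℤ.* d ℤ.* (s ℤ.* (n ℤ.* e)) ≡ s ℤ.* (q ℤ.* n ℤ.* (d ℤ.* e))
    regroup = solve-∀

-- The embedding of ℤ into ℂ.

module ℂR = CommutativeRing ℂ-commutativeRing

pointwiseᶜ : ∀ {z w} → (∀ n → seq (re z) n ≡ seq (re w) n) → (∀ n → seq (im z) n ≡ seq (im w) n) → z ≈ᶜ w
pointwiseᶜ p q = record { re-≈ = pointwise p ; im-≈ = pointwise q }

abstract

  -- Division in ℚ normalises its result, which does not compute for a variable numerator.
  -- Unnormalised fractions with denominator 1 do compute, so the homomorphism laws are checked
  -- there.
  toℚᵘ-/1 : ∀ k → ℚ.toℚᵘ (k ℚ./ 1) ℚᵘ.≃ ℚᵘ.mkℚᵘ k 0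
  toℚᵘ-/1 k = ℚP.toℚᵘ-fromℚᵘ (ℚᵘ.mkℚᵘ k 0)

  /1-homo-+ : ∀ k l → (k ℤ.+ l) ℚ./ 1 ≡ k ℚ./ 1 ℚ.+ l ℚ./ 1
  /1-homo-+ k l = ℚP.toℚᵘ-injective (ℚᵘP.≃-trans (toℚᵘ-/1 (k ℤ.+ l))
    (ℚᵘP.≃-trans (ℚᵘP.≃-reflexive (cong (λ t → ℚᵘ.mkℚᵘ t 0)
        (sym (cong₂ ℤ._+_ (ℤP.*-identityʳ k) (ℤP.*-identityʳ l)))))
      (ℚᵘP.≃-sym (ℚᵘP.≃-trans (ℚP.toℚᵘ-homo-+ (k ℚ./ 1) (l ℚ./ 1)) (ℚᵘP.+-cong (toℚᵘ-/1 k) (toℚᵘ-/1 l))))))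

  /1-homo-* : ∀ k l → (k ℤ.* l) ℚ./ 1 ≡ k ℚ./ 1 ℚ.* (l ℚ./ 1)
  /1-homo-* k l = ℚP.toℚᵘ-injective (ℚᵘP.≃-trans (toℚᵘ-/1 (k ℤ.* l))
    (ℚᵘP.≃-sym (ℚᵘP.≃-trans (ℚP.toℚᵘ-homo-* (k ℚ./ 1) (l ℚ./ 1)) (ℚᵘP.*-cong (toℚᵘ-/1 k) (toℚᵘ-/1 l)))))

  fromℤ-homo-+ : ∀ k l → fromℤ (k ℤ.+ l) ≈ᶜ fromℤ k +ᶜ fromℤ l
  fromℤ-homo-+ k l = pointwiseᶜ (λ _ → /1-homo-+ k l) (λ _ → refl)

  fromℤ-homo-* : ∀ k l → fromℤ (k ℤ.* l) ≈ᶜ fromℤ k *ᶜ fromℤ l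
  fromℤ-homo-* k l = pointwiseᶜ
    (λ _ → trans (/1-homo-* k l) (solve 2 (λ a b → a :* b := a :* b :+ (:- (con 0ℚ :* con 0ℚ))) refl (k ℚ./ 1) (l ℚ./ 1)))
    (λ _ → solve 2 (λ a b → con 0ℚ := a :* con 0ℚ :+ con 0ℚ :* b) refl (k ℚ./ 1) (l ℚ./ 1))
    where open +-*-Solver using (solve; _:+_; _:*_; :-_; _:=_; con)

  fromℤ-sum : ∀ {n} (f : Fin n → ℤ) → fromℤ (ℤM.sum f) ≈ᶜ ℂM.sum (λ k → fromℤ (f k))
  fromℤ-sum {zero}  f = ℂR.refl
  fromℤ-sum {suc n} f = ℂR.trans (fromℤ-homo-+ (f zero) (ℤM.sum (λ k → f (suc k))))
    (ℂR.+-congˡ (fromℤ-sum (λ k → f (suc k))))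

  fromℤ-𝐈 : ∀ {n} (x y : Fin n) → fromℤ (𝐈 x y) ≈ᶜ ℂM.𝐈 x y
  fromℤ-𝐈 x y with x Fin.≟ y
  ... | yes _ = ℂR.refl
  ... | no  _ = ℂR.refl

-- The embedding is a ring homomorphism, so the integer coefficients, embedded, still work.
⟪⟫-∈Span : ∀ {r m n} {B : Matrix m n} {A : Fin r → Matrix m n} →
           B ∈Span A → ⟪ B ⟫ ℂS.∈Span (λ k → ⟪ A k ⟫)
⟪⟫-∈Span {B = B} {A} (b , B≋) = (λ k → fromℤ (b k)) , λ x y →
  ℂR.trans (ℂR.reflexive (cong fromℤ (B≋ x y)))
    (ℂR.trans (fromℤ-sum (λ k → b k ℤ.* A k x y)) (ℂM.sum-cong-≋ λ k → fromℤ-homo-* (b k) (A k x y)))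

-- Expansion of H H* over ℂ.

abstract

  -- This is one summand of an entry of H H*. Conjugation only changes the sign of i, so the two
  -- cross terms get opposite coefficients. Arithmetic in ℝ is termwise on sequences, which reduces
  -- the claim to polynomial identities over ℚ.
  *ᶜ-conj : ∀ (a b j k j′ k′ : ℝ) →
    (fromℝ a *ᶜ fromℝ j +ᶜ (𝕚 *ᶜ fromℝ b) *ᶜ fromℝ k) *ᶜ
      conj (fromℝ a *ᶜ fromℝ j′ +ᶜ (𝕚 *ᶜ fromℝ b) *ᶜ fromℝ k′) ≈ᶜ
    fromℝ (a *ᴿ a) *ᶜ (fromℝ j *ᶜ fromℝ j′) +ᶜ (fromℝ (b *ᴿ b) *ᶜ (fromℝ k *ᶜ fromℝ k′) +ᶜ
      ((𝕚 *ᶜ fromℝ (a *ᴿ b)) *ᶜ (fromℝ k *ᶜ fromℝ j′) +ᶜ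
       (-ᶜ (𝕚 *ᶜ fromℝ (a *ᴿ b))) *ᶜ (fromℝ j *ᶜ fromℝ k′)))
  *ᶜ-conj a b j k j′ k′ = pointwiseᶜ
    (λ n → solve 6 (λ a b j k j′ k′ → proj₁ (lhs a b j k j′ k′) := proj₁ (rhs a b j k j′ k′)) refl
      (seq a n) (seq b n) (seq j n) (seq k n) (seq j′ n) (seq k′ n))
    (λ n → solve 6 (λ a b j k j′ k′ → proj₂ (lhs a b j k j′ k′) := proj₂ (rhs a b j k j′ k′)) refl
      (seq a n) (seq b n) (seq j n) (seq k n) (seq j′ n) (seq k′ n))
    where
    open +-*-Solver using (solve; Polynomial; _:+_; _:*_; :-_; _:=_; con)
    -- Real and imaginary parts, mirroring the operations of ℂ so that both sides reduce to the ones above.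
    Poly : ℕ → Set
    Poly n = Polynomial n × Polynomial n
    infixl 6 _⊞_
    infixl 7 _⊠′_
    _⊞_ _⊠′_ : ∀ {n} → Poly n → Poly n → Poly n
    (a , b) ⊞ (c , d)  = a :+ c , b :+ d
    (a , b) ⊠′ (c , d) = a :* c :+ (:- (b :* d)) , a :* d :+ b :* c
    real : ∀ {n} → Polynomial n → Poly n
    real a = a , con 0ℚ
    i : ∀ {n} → Poly n
    i = con 0ℚ , con 1ℚ
    bar minus : ∀ {n} → Poly n → Poly n
    bar (a , b) = a , :- b
    minus (a , b) = :- a , :- b
    lhs rhs : ∀ {n} (a b j k j′ k′ : Polynomial n) → Poly n
    lhs a b j k j′ k′ = (real a ⊠′ real j ⊞ (i ⊠′ real b) ⊠′ real k) ⊠′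
      bar (real a ⊠′ real j′ ⊞ (i ⊠′ real b) ⊠′ real k′)
    rhs a b j k j′ k′ = real (a :* a) ⊠′ (real j ⊠′ real j′) ⊞ (real (b :* b) ⊠′ (real k ⊠′ real k′) ⊞
      ((i ⊠′ real (a :* b)) ⊠′ (real k ⊠′ real j′) ⊞ minus (i ⊠′ real (a :* b)) ⊠′ (real j ⊠′ real k′)))

  fromℝ-cong : ∀ {x y} → x ≈ᴿ y → fromℝ x ≈ᶜ fromℝ y
  fromℝ-cong e = record { re-≈ = e ; im-≈ = ≈ᴿ-refl }

  /≡1/-* : ∀ a b → + a ℚ./ suc b ≡ + 1 ℚ./ suc b ℚ.* (+ a ℚ./ 1)
  /≡1/-* a b = sym (trans (Fraction.times 1 b a 0)
    (Fraction.eq (1 ℕ.* a) (b ℕ.* 1) a b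
      (trans (cong (ℕ._* suc b) (ℕP.*-identityˡ a)) (cong (a ℕ.*_) (sym (ℕP.*-identityʳ (suc b)))))))

  -- Splits q/(q+1) as 1/(q+1) times an integer, so that both squared coefficients share the factor
  -- 1/(q+1).
  fromℝ-fraction : ∀ a b → fromℝ (fromℚ (+ a ℚ./ suc b)) ≈ᶜ fromℝ (fromℚ (+ 1 ℚ./ suc b)) *ᶜ fromℤ (+ a)
  fromℝ-fraction a b = pointwiseᶜ
    (λ _ → trans (/≡1/-* a b) (solve 2 (λ u v → u :* v := u :* v :+ (:- (con 0ℚ :* con 0ℚ))) refl (+ 1 ℚ./ suc b) (+ a ℚ./ 1)))
    (λ _ → solve 2 (λ u v → con 0ℚ := u :* con 0ℚ :+ con 0ℚ :* v) refl (+ 1 ℚ./ suc b) (+ a ℚ./ 1))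
    where open +-*-Solver using (solve; _:+_; _:*_; :-_; _:=_; con)

  1/n*n : ∀ b → fromℝ (fromℚ (+ 1 ℚ./ suc b)) *ᶜ fromℤ (+ suc b) ≈ᶜ ℂR.1#
  1/n*n b = ℂR.trans (ℂR.sym (fromℝ-fraction (suc b) b)) (ℂR.reflexive (cong (λ p → fromℝ (fromℚ p))
    (Fraction.eq (suc b) b 1 0 (ℕP.*-comm (suc b) 1))))

module Gram {n : ℕ} (J A : Matrix n n) (AJᵀ≋JAᵀ : A · J ᵀ ≋ J · A ᵀ) where

  open SetoidReasoning ℂR.setoid

  -- Integer entries are real, so H* involves only plain transposes of J and A. Summation leaves
  -- four integer products, and the two mixed ones, with opposite coefficients, cancel by `AJᵀ≋JAᵀ`.
  gram : ∀ (a b : ℝ) → let H = fromℝ a ℂM.• ⟪ J ⟫ ℂM.⊕ (𝕚 *ᶜ fromℝ b) ℂM.• ⟪ A ⟫ in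
    H ℂM.· (H †) ℂM.≋ fromℝ (a *ᴿ a) ℂM.• ⟪ J · J ᵀ ⟫ ℂM.⊕ fromℝ (b *ᴿ b) ℂM.• ⟪ A · A ᵀ ⟫
  gram a b x y = begin
    ℂM.sum {n} (λ z → H x z *ᶜ conj (H y z))
      ≈⟨ ℂM.sum-cong-≋ {n} (λ z → *ᶜ-conj a b (r J x z) (r A x z) (r J y z) (r A y z)) ⟩
    ℂM.sum {n} (λ z → p *ᶜ t J J z +ᶜ (s *ᶜ t A A z +ᶜ (c *ᶜ t A J z +ᶜ (-ᶜ c) *ᶜ t J A z)))
      ≈⟨ ℂR.trans (ℂM.∑-distrib-+ {n} (λ z → p *ᶜ t J J z) (λ z → s *ᶜ t A A z +ᶜ (c *ᶜ t A J z +ᶜ (-ᶜ c) *ᶜ t J A z)))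
           (ℂR.+-congˡ (ℂR.trans (ℂM.∑-distrib-+ {n} (λ z → s *ᶜ t A A z) (λ z → c *ᶜ t A J z +ᶜ (-ᶜ c) *ᶜ t J A z))
             (ℂR.+-congˡ (ℂM.∑-distrib-+ {n} (λ z → c *ᶜ t A J z) (λ z → (-ᶜ c) *ᶜ t J A z))))) ⟩
    ℂM.sum {n} (λ z → p *ᶜ t J J z) +ᶜ (ℂM.sum {n} (λ z → s *ᶜ t A A z) +ᶜ
      (ℂM.sum {n} (λ z → c *ᶜ t A J z) +ᶜ ℂM.sum {n} (λ z → (-ᶜ c) *ᶜ t J A z)))
      ≈⟨ ℂR.+-cong (collect p J J) (ℂR.+-cong (collect s A A) (ℂR.+-cong (collect c A J) (collect (-ᶜ c) J A))) ⟩
    p *ᶜ g J J +ᶜ (s *ᶜ g A A +ᶜ (c *ᶜ g A J +ᶜ (-ᶜ c) *ᶜ g J A))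
      ≈⟨ ℂR.+-congˡ (ℂR.+-congˡ cross) ⟩
    p *ᶜ g J J +ᶜ (s *ᶜ g A A +ᶜ ℂR.0#)
      ≈⟨ ℂR.+-congˡ (ℂR.+-identityʳ (s *ᶜ g A A)) ⟩
    p *ᶜ g J J +ᶜ s *ᶜ g A A ∎
    where
    H : ℂM.Matrix n n
    H = fromℝ a ℂM.• ⟪ J ⟫ ℂM.⊕ (𝕚 *ᶜ fromℝ b) ℂM.• ⟪ A ⟫
    p s c : ℂ
    p = fromℝ (a *ᴿ a)
    s = fromℝ (b *ᴿ b)
    c = 𝕚 *ᶜ fromℝ (a *ᴿ b)
    -- By definition `fromℤ (B x y)` is `fromℝ (r B x y)`, the form to which `*ᶜ-conj` applies.
    r : Matrix n n → Fin n → Fin n → ℝ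
    r B x y = fromℚ (B x y ℚ./ 1)
    t : Matrix n n → Matrix n n → Fin n → ℂ
    t B C z = fromℤ (B x z) *ᶜ fromℤ (C y z)
    g : Matrix n n → Matrix n n → ℂ
    g B C = fromℤ ((B · C ᵀ) x y)
    collect : ∀ u B C → ℂM.sum {n} (λ z → u *ᶜ t B C z) ≈ᶜ u *ᶜ g B C
    collect u B C = ℂR.sym (begin
      u *ᶜ g B C
        ≈⟨ ℂR.*-congˡ {u} (ℂR.trans (fromℤ-sum (λ z → B x z ℤ.* C y z))
             (ℂM.sum-cong-≋ {n} λ z → fromℤ-homo-* (B x z) (C y z))) ⟩
      u *ᶜ ℂM.sum {n} (t B C)
        ≈⟨ ℂM.*-distribˡ-sum u (t B C) ⟩
      ℂM.sum {n} (λ z → u *ᶜ t B C z) ∎)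
    cross : c *ᶜ g A J +ᶜ (-ᶜ c) *ᶜ g J A ≈ᶜ ℂR.0#
    cross = begin
      c *ᶜ g A J +ᶜ (-ᶜ c) *ᶜ g J A
        ≈⟨ ℂR.+-congʳ {(-ᶜ c) *ᶜ g J A} (ℂR.reflexive (cong (λ k → c *ᶜ fromℤ k) (AJᵀ≋JAᵀ x y))) ⟩
      c *ᶜ g J A +ᶜ (-ᶜ c) *ᶜ g J A
        ≈⟨ ℂR.distribʳ (g J A) c (-ᶜ c) ⟨
      (c +ᶜ -ᶜ c) *ᶜ g J A
        ≈⟨ ℂR.*-congʳ {g J A} (ℂR.-‿inverseʳ c) ⟩
      ℂR.0# *ᶜ g J A
        ≈⟨ ℂR.zeroˡ (g J A) ⟩
      ℂR.0# ∎

-- The unit Hadamard property and the theorem.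

unitHadamard : ∀ {q} {Q A₁ A₂ : Matrix q q} → IsSkewSymmetricCore Q → Splitting Q A₁ A₂ → ∀ m →
               IsQuaternaryUnitHadamard q (quaternaryUnitMatrix Q m)
unitHadamard {q} {Q} core split m =
  -- The two signs of an entry are the entries of `𝒥` and `𝒜` themselves; only the order of the
  -- factors differs.
  (λ x y → 𝒥 Q m x y , 𝒜 Q m x y , 𝒥-sign core split m x y , 𝒜-sign core split m x y ,
    ℂR.+-cong (ℂR.*-comm a (fromℤ (𝒥 Q m x y))) (ℂR.*-comm (𝕚 *ᶜ b) (fromℤ (𝒜 Q m x y)))) ,
  λ x y → let jj = (𝒥 Q m · 𝒥 Q m ᵀ) x y ; aa = (𝒜 Q m · 𝒜 Q m ᵀ) x y in begin
    (H ℂM.· (H †)) x y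
      ≈⟨ Gram.gram (𝒥 Q m) (𝒜 Q m) (𝒜𝒥ᵀ≋𝒥𝒜ᵀ core split m) (√ 1 / suc q) (√ q / suc q) x y ⟩
    fromℝ ((√ 1 / suc q) *ᴿ (√ 1 / suc q)) *ᶜ fromℤ jj +ᶜ fromℝ ((√ q / suc q) *ᴿ (√ q / suc q)) *ᶜ fromℤ aa
      -- The squared roots become 1/(q+1) and q/(q+1). Taking out `w` = 1/(q+1) leaves the integer
      -- expression of the Gram identity.
      ≈⟨ ℂR.+-cong (ℂR.*-congʳ {fromℤ jj} (fromℝ-cong (√-square 1 (suc q))))
           (ℂR.*-congʳ {fromℤ aa} (ℂR.trans (fromℝ-cong (√-square q (suc q))) (fromℝ-fraction q q))) ⟩
    w *ᶜ fromℤ jj +ᶜ (w *ᶜ fromℤ (+ q)) *ᶜ fromℤ aa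
      ≈⟨ ℂR.+-congˡ {w *ᶜ fromℤ jj} (ℂR.trans (ℂR.*-assoc w (fromℤ (+ q)) (fromℤ aa))
           (ℂR.*-congˡ {w} (ℂR.sym (fromℤ-homo-* (+ q) aa)))) ⟩
    w *ᶜ fromℤ jj +ᶜ w *ᶜ fromℤ (+ q ℤ.* aa)
      ≈⟨ ℂR.trans (ℂR.sym (ℂR.distribˡ w (fromℤ jj) (fromℤ (+ q ℤ.* aa))))
           (ℂR.*-congˡ {w} (ℂR.sym (fromℤ-homo-+ jj (+ q ℤ.* aa)))) ⟩
    w *ᶜ fromℤ (jj ℤ.+ + q ℤ.* aa)
      ≈⟨ ℂR.reflexive (cong (λ k → w *ᶜ fromℤ k) (𝒥𝒥ᵀ+q𝒜𝒜ᵀ core split m x y)) ⟩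
    w *ᶜ fromℤ (+ suc q ℤ.* (+ (q ^ m) ℤ.* 𝐈 x y))
      ≈⟨ ℂR.*-congˡ {w} (fromℤ-homo-* (+ suc q) (+ (q ^ m) ℤ.* 𝐈 x y)) ⟩
    w *ᶜ (fromℤ (+ suc q) *ᶜ fromℤ (+ (q ^ m) ℤ.* 𝐈 x y))
      ≈⟨ ℂR.sym (ℂR.*-assoc w (fromℤ (+ suc q)) (fromℤ (+ (q ^ m) ℤ.* 𝐈 x y))) ⟩
    (w *ᶜ fromℤ (+ suc q)) *ᶜ fromℤ (+ (q ^ m) ℤ.* 𝐈 x y)
      -- The factor q + 1 of the Gram identity cancels `w`, so exactly the order `q ^ m` remains.
      ≈⟨ ℂR.*-congʳ {fromℤ (+ (q ^ m) ℤ.* 𝐈 x y)} (1/n*n q) ⟩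
    ℂR.1# *ᶜ fromℤ (+ (q ^ m) ℤ.* 𝐈 x y)
      ≈⟨ ℂR.*-identityˡ (fromℤ (+ (q ^ m) ℤ.* 𝐈 x y)) ⟩
    fromℤ (+ (q ^ m) ℤ.* 𝐈 x y)
      ≈⟨ ℂR.trans (fromℤ-homo-* (+ (q ^ m)) (𝐈 x y)) (ℂR.*-congˡ {fromℤ (+ (q ^ m))} (fromℤ-𝐈 x y)) ⟩
    fromℤ (+ (q ^ m)) *ᶜ ℂM.𝐈 x y ∎
  where
  open SetoidReasoning ℂR.setoid
  a b w : ℂ
  a = fromℝ (√ 1 / suc q)
  b = fromℝ (√ q / suc q)
  w = fromℝ (fromℚ (+ 1 ℚ./ suc q))
  H : ℂM.Matrix (q ^ m) (q ^ m)
  H = quaternaryUnitMatrix Q m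

proposition4p1 : (q : ℕ) (Q A₁ A₂ : Matrix q q) (core : IsSkewSymmetricCore Q) (split : Splitting Q A₁ A₂)
    (q>1 : 1 < q) (m : ℕ) → 1 ≤ m →
    IsQuaternaryUnitHadamard q (quaternaryUnitMatrix Q m) ×
    quaternaryUnitMatrix Q m ∈BoseMesner (𝔛 q>1 core split ^⊠ m)
proposition4p1 q Q A₁ A₂ core split q>1 m _ =
  unitHadamard core split m ,
  ℂS.∈Span-⊕ (ℂS.∈Span-• (fromℝ (√ 1 / suc q)) (⟪⟫-∈Span (𝒥-∈Span core split q>1 m)))
    (ℂS.∈Span-• (𝕚 *ᶜ fromℝ (√ q / suc q)) (⟪⟫-∈Span (𝒜-∈Span core split q>1 m)))
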